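{- Let $(X,\mathcal{F})$ be a set system. Then the following are equivalent. 1. $(X,\mathcal{F})$ is a well-graded family with VC-dimension at most $1$. 2. $(X,\mathcal{F})$ is extremal with VC-dimension at most $1$. 3. The graph $G_{\mathcal{F}}$ is connected and $|ess_{\mathcal{F}}(X)|+1=|\mathcal{F}|=|E(G_{\mathcal{F}})|+1$. 4. $(X,\mathcal{F})$ is well-graded and $|\mathcal{F}|=|E(G_{\mathcal{F}})|+1$. 5. $(X,\mathcal{F})$ is well-graded with additionality $1$ (or equivalently, it is well-graded and $|ess_{\mathcal{F}}(X)|+1=|\mathcal{F}|$). 6. The graph $G_{\mathcal{F}}$ is a tree and all labels on its edges are different. 7. The graph $G_{\mathcal{F}}$ is a tree with $|ess_{\mathcal{F}}(X)|+1$ vertices and $|ess_{\mathcal{F}}(X)|$ edges, where the labels of edges are elements of $ess_{\mathcal{F}}(X)$ and each one is used once. 8. For every $A\in\mathcal{F}$, setting $\mathcal{F}'=flip(\mathcal{F},A\rightarrow\emptyset)$, the graph $G_{\mathcal{F}'}$ is a uniformly directed rooted tree with root $v_\emptyset$ and distinct labels on the edges. 9. For some $A\in\mathcal{F}$, setting $\mathcal{F}'=flip(\mathcal{F},A\rightarrow\emptyset)$, the graph $G_{\mathcal{F}'}$ is a uniformly directed rooted tree with root $v_\emptyset$ and distinct labels on the edges.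
   Context: A set system $(X,\mathcal{F})$ is a finite set $X$ together with a nonempty family $\mathcal{F}$ of distinct subsets of $X$. Its one-inclusion graph $G_{\mathcal{F}}$ is the edge-labelled directed graph with one vertex $v_A$ for each $A\in\mathcal{F}$ and a directed edge from $v_A$ to $v_B$ with label $b$ whenever $B=A\cup\{b\}$ for some $b\in X\setminus A$; $E(G_{\mathcal{F}})$ is its edge set. For directed graphs, connectedness, being a tree, and distances refer to the underlying undirected graph (the distance is infinite if there is no path). The system is well-graded if $|A\triangle B|=d_{G_{\mathcal{F}}}(v_A,v_B)$ for all $A,B\in\mathcal{F}$. $x\in X$ is essential if there are $A,B\in\mathcal{F}$ with $x\in A$, $x\notin B$; $ess_{\mathcal{F}}(X)$ is the set of essential elements. The additionality is $|\mathcal{F}|-|ess_{\mathcal{F}}(X)|$. $Y\subseteq X$ is shattered by $\mathcal{F}$ if $\{A\cap Y:A\in\mathcal{F}\}$ is the full power set of $Y$; the VC-dimension is the largest size of a shattered set. $Y$ is strongly shattered by $\mathcal{F}$ if there is $T\subseteq X\setminus Y$ with $\{Z\cup T:Z\subseteq Y\}\subseteq\mathcal{F}$. The system is extremal if every shattered set is strongly shattered (equivalently, the two collections of sets coincide). For $A\in\mathcal{F}$, $flip(\mathcal{F},A\rightarrow\emptyset)$ is the system on $X$ obtained by applying to $\mathcal{F}$ the bit-flip operation on $a$ for every $a\in A$, where bit-flip on $a$ replaces each member $C$ by $C\setminus\{a\}$ if $a\in C$ and by $C\cup\{a\}$ if $a\notin C$; i.e. it equals $\{C\triangle A:C\in\mathcal{F}\}$.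 A directed rooted tree is uniformly directed if every edge is directed from its endpoint closer to the root to its other endpoint. -}

module Defs where

import Data.Bool.Properties as Bool
open import Data.Fin.Base using (Fin)
open import Data.Fin.Subset
open import Data.Fin.Subset.Properties using (_∈?_)
open import Data.Integer.Base as ℤ using (ℤ; +_)
open import Data.List.Base using (List; []; _∷_; length; filter; cartesianProduct; allFin)
  renaming (map to mapList)
import Data.List.Membership.Propositional as List
open import Data.List.Membership.Propositional.Properties
  using (∈-map⁺; ∈-filter⁻; ∈-cartesianProduct⁻)
open import Data.List.Relation.Unary.Any using (any?)
open import Data.List.Relation.Unary.Unique.Propositional using (Unique)
import Data.List.Relation.Unary.Unique.Propositional.Properties as Unique
open import Data.Nat.Base using (ℕ; zero; suc; _≤_; _<_)
open import Data.Product.Base using (Σ; ∃; ∃₂; _×_; _,_; proj₁; proj₂)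
open import Data.Sum.Base using (_⊎_)
open import Data.Vec.Base using ([]; _∷_; tabulate)
open import Data.Vec.Properties using (≡-dec; ∷-injectiveʳ)
open import Relation.Binary.Construct.Closure.ReflexiveTransitive using (Star; ε; _◅_)
open import Relation.Binary.Definitions using (DecidableEquality)
open import Relation.Binary.PropositionalEquality.Core using (_≡_; refl; cong)
open import Relation.Nullary using (¬_; Dec; does)
open import Relation.Nullary.Decidable using (map′; ¬?; _×-dec_)

-- An edge is a triple (source , label , target).
label : {V L : Set} → V × L × V → L
label (_ , l , _) = l

record LabelledDigraph (V L : Set) : Set where
  field
    vertices        : List V
    vertices-unique : Unique vertices
    edges           : List (V × L × V)
    edges-unique    : Unique edges
    incident        : ∀ {s l t} → (s , l , t) List.∈ edges →
                      s List.∈ vertices × t List.∈ vertices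

  Vertex : V → Set
  Vertex v = v List.∈ vertices

  order : ℕ
  order = length vertices

  edgeCount : ℕ
  edgeCount = length edges

  labels : List L
  labels = mapList label edges

  DistinctLabels : Set
  DistinctLabels = Unique labels

  -- Adjacency in the underlying undirected graph.
  Adjacent : V → V → Set
  Adjacent u v = ∃ λ l → (u , l , v) List.∈ edges ⊎ (v , l , u) List.∈ edges

  Walk : V → V → Set
  Walk = Star Adjacent

  walkLength : ∀ {u v} → Walk u v → ℕ
  walkLength ε       = zero
  walkLength (_ ◅ w) = suc (walkLength w)

  -- All vertices visited by a walk except the final one.
  starts : ∀ {u v} → Walk u v → List V
  starts ε           = []
  starts {u} (_ ◅ w) = u ∷ starts w

  Connected : Set
  Connected = ∀ {u v} → Vertex u → Vertex v → Walk u v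

  -- Requiring length at least 3 is right when the underlying undirected graph
  -- is simple. One-inclusion graphs are: |target| = |source| + 1 rules out
  -- loops and opposite edges, and the label is determined by the endpoints.
  Cycle : Set
  Cycle = ∃ λ v → Σ (Walk v v) λ w → 3 ≤ walkLength w × Unique (starts w)

  Tree : Set
  Tree = Connected × ¬ Cycle

  -- "d(u, v) = d".  No d satisfies this when the distance is infinite.
  IsDistance : V → V → ℕ → Set
  IsDistance u v d = (Σ (Walk u v) λ w → walkLength w ≡ d)
                   × ((w : Walk u v) → d ≤ walkLength w)

  CloserTo : V → V → V → Set
  CloserTo r u v = ∃₂ λ i j → IsDistance r u i × IsDistance r v j × i < j

  UniformlyDirectedTree : V → Set
  UniformlyDirectedTree r = Tree × Vertex r
    × (∀ {s l t} → (s , l , t) List.∈ edges → CloserTo r s t)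

-- The ground set X is Fin n.  The family is listed without repetition; no
-- notion below depends on the order of the list.
record SetSystem (n : ℕ) : Set where
  field
    members  : List (Subset n)
    unique   : Unique members
    nonempty : ∃ λ A → A List.∈ members

open SetSystem public

infix 4 _∈ᶠ_

_∈ᶠ_ : ∀ {n} → Subset n → SetSystem n → Set
A ∈ᶠ F = A List.∈ members F

size : ∀ {n} → SetSystem n → ℕ
size F = length (members F)

infixl 6 _△_

_△_ : ∀ {n} → Subset n → Subset n → Subset n
A △ B = (A ─ B) ∪ (B ─ A)

_≟ˢ_ : ∀ {n} → DecidableEquality (Subset n)
_≟ˢ_ = ≡-dec Bool._≟_

module _ {n : ℕ} where

  IsInclusionEdge : Subset n × Fin n × Subset n → Set
  IsInclusionEdge (A , b , B) = b ∉ A × B ≡ A ∪ ⁅ b ⁆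

  isInclusionEdge? : ∀ e → Dec (IsInclusionEdge e)
  isInclusionEdge? (A , b , B) = ¬? (b ∈? A) ×-dec (B ≟ˢ (A ∪ ⁅ b ⁆))

  oneInclusionGraph : SetSystem n → LabelledDigraph (Subset n) (Fin n)
  oneInclusionGraph F = record
    { vertices        = members F
    ; vertices-unique = unique F
    ; edges           = filter isInclusionEdge? candidates
    ; edges-unique    = Unique.filter⁺ isInclusionEdge?
        (Unique.cartesianProduct⁺ (unique F)
          (Unique.cartesianProduct⁺ (Unique.allFin⁺ n) (unique F)))
    ; incident        = λ e∈ →
        let s∈ , lt∈ = ∈-cartesianProduct⁻ (members F) _
                         (proj₁ (∈-filter⁻ isInclusionEdge? e∈))
        in s∈ , proj₂ (∈-cartesianProduct⁻ (allFin n) (members F) lt∈)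
    }
    where candidates = cartesianProduct (members F) (cartesianProduct (allFin n) (members F))

  WellGraded : SetSystem n → Set
  WellGraded F = ∀ {A B} → A ∈ᶠ F → B ∈ᶠ F →
    LabelledDigraph.IsDistance (oneInclusionGraph F) A B ∣ A △ B ∣

  Essential : SetSystem n → Fin n → Set
  Essential F x = (∃ λ A → A ∈ᶠ F × x ∈ A) × (∃ λ B → B ∈ᶠ F × x ∉ B)

  essential? : ∀ F x → Dec (Essential F x)
  essential? F x =
    map′ List.find (λ (_ , A∈F , x∈A) → List.lose A∈F x∈A) (any? (x ∈?_) (members F))
    ×-dec
    map′ List.find (λ (_ , B∈F , x∉B) → List.lose B∈F x∉B) (any? (λ B → ¬? (x ∈? B)) (members F))

  ess : SetSystem n → Subset n
  ess F = tabulate λ x → does (essential? F x)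

  additionality : SetSystem n → ℤ
  additionality F = + size F ℤ.- + ∣ ess F ∣

  -- Only one inclusion between {A ∩ Y : A ∈ F} and the power set of Y needs
  -- stating; the other always holds.
  Shattered : SetSystem n → Subset n → Set
  Shattered F Y = ∀ {Z} → Z ⊆ Y → ∃ λ A → A ∈ᶠ F × A ∩ Y ≡ Z

  StronglyShattered : SetSystem n → Subset n → Set
  StronglyShattered F Y = ∃ λ T → T ⊆ ∁ Y × (∀ {Z} → Z ⊆ Y → Z ∪ T ∈ᶠ F)

  Extremal : SetSystem n → Set
  Extremal F = ∀ {Y} → Shattered F Y → StronglyShattered F Y

  IsVCDimension : SetSystem n → ℕ → Set
  IsVCDimension F d = (∃ λ Y → Shattered F Y × ∣ Y ∣ ≡ d)
                    × (∀ {Y} → Shattered F Y → ∣ Y ∣ ≤ d)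

  VCDimensionAtMost : ℕ → SetSystem n → Set
  VCDimensionAtMost k F = ∃ λ d → IsVCDimension F d × d ≤ k

△-cancelʳ : ∀ {n} (A : Subset n) {C D} → C △ A ≡ D △ A → C ≡ D
△-cancelʳ []              {[]}        {[]}        _  = refl
△-cancelʳ (inside  ∷ A) {inside  ∷ _} {inside  ∷ _} eq = cong (_ ∷_) (△-cancelʳ A (∷-injectiveʳ eq))
△-cancelʳ (inside  ∷ A) {inside  ∷ _} {outside ∷ _} ()
△-cancelʳ (inside  ∷ A) {outside ∷ _} {inside  ∷ _} ()
△-cancelʳ (inside  ∷ A) {outside ∷ _} {outside ∷ _} eq = cong (_ ∷_) (△-cancelʳ A (∷-injectiveʳ eq))
△-cancelʳ (outside ∷ A) {inside  ∷ _} {inside  ∷ _} eq = cong (_ ∷_) (△-cancelʳ A (∷-injectiveʳ eq))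
△-cancelʳ (outside ∷ A) {inside  ∷ _} {outside ∷ _} ()
△-cancelʳ (outside ∷ A) {outside ∷ _} {inside  ∷ _} ()
△-cancelʳ (outside ∷ A) {outside ∷ _} {outside ∷ _} eq = cong (_ ∷_) (△-cancelʳ A (∷-injectiveʳ eq))

flip : ∀ {n} → SetSystem n → Subset n → SetSystem n
flip F A = record
  { members  = mapList (_△ A) (members F)
  ; unique   = Unique.map⁺ (△-cancelʳ A) (unique F)
  ; nonempty = let C , C∈F = nonempty F in C △ A , ∈-map⁺ (_△ A) C∈F
  }

module Submission where

-- The conditions are all equivalent to the following: any two members are joined by a geodesic of
-- the Hamming cube inside the family, and no two edges carry the same label.  Connectedness and
-- distinct labels suffice for this, because a step away from the target has to be undone later along
-- the only edge with its label.  VC-dimension at most 1 makes labels distinct, because two parallel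
-- edges shatter a pair.  For the counting conditions, fix a root r: in an isometric system every
-- other vertex has an edge towards r, and every essential label is the only label towards r at some
-- vertex.  Hence equality in |ess| + 1 ≤ |F| ≤ |E| + 1, on either side, makes the edge towards r
-- unique at each vertex; taking r at the end of an edge excludes a parallel edge.

open import Defs
open import Data.Bool.Base using (Bool; true; false; not; _∧_; _xor_)
open import Data.Bool.Properties using (not-¬; ¬-not; not-involutive; ∨-identityʳ; ∧-identityʳ; ∧-zeroʳ)
import Data.Bool.Properties as 𝔹
open import Data.Fin.Base using (Fin; zero; suc)
import Data.Fin.Properties as Fin
open import Data.Fin.Subset
open import Data.Fin.Subset.Properties
open import Data.Integer.Base as ℤ using (1ℤ)
import Data.Integer.Properties as ℤ
open import Data.List.Base using (List; []; _∷_; _++_; [_]; length; map; allFin)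
import Data.List.Membership.DecPropositional as DecList
import Data.List.Membership.Propositional as List
open import Data.List.Membership.Propositional.Properties
  using (∈-map⁺; ∈-map⁻; ∈-∃++; ∈-++⁺ˡ; ∈-++⁺ʳ; ∈-filter⁺; ∈-filter⁻
        ; ∈-cartesianProduct⁺; ∈-cartesianProduct⁻; ∈-allFin)
open import Data.List.Properties using (length-map)
open import Data.List.Relation.Binary.Permutation.Propositional using (_↭_; ↭-sym; ↭⇒↭ₛ)
open import Data.List.Relation.Binary.Permutation.Propositional.Properties
  using (shift; ↭-length; ∈-resp-↭)
import Data.List.Relation.Binary.Permutation.Setoid.Properties as Permutation
open import Data.List.Relation.Unary.All as All using (All; []; _∷_)
open import Data.List.Relation.Unary.AllPairs using (AllPairs; []; _∷_)
open import Data.List.Relation.Unary.Any using (here; there)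
open import Data.List.Relation.Unary.Unique.Propositional using (Unique)
import Data.List.Relation.Unary.Unique.Propositional.Properties as Unique
open import Data.Nat.Base using (ℕ; zero; suc; _+_; _≤_; _<_; z≤n; s≤s)
open import Data.Nat.Induction using (<-wellFounded)
import Data.Nat.Properties as ℕ
open import Data.Product using (Σ; ∃; ∃!; _×_; _,_; proj₁; proj₂; map₂)
open import Data.Sum.Base using (_⊎_; inj₁; inj₂)
open import Data.Vec.Base as Vec using ([]; _∷_; lookup; _[_]≔_; _[_]%=_)
open import Data.Vec.Properties
  using ([]=⇒lookup; lookup⇒[]=; lookup-zipWith; lookup-replicate
        ; updateAt-id-local; updateAt-updateAt; updateAt-cong-local; lookup∘updateAt; lookup∘updateAt′
        ; []≔-idempotent; []≔-lookup; lookup∘update; lookup∘update′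
        ; tabulate∘lookup; tabulate-cong; lookup∘tabulate)
open import Function.Base using (_∘_; id)
open import Function.Bundles using (_⇔_; mk⇔; module Equivalence)
import Function.Properties.Equivalence as ⇔
open import Induction.WellFounded using (Acc; acc)
open import Relation.Binary.Construct.Closure.ReflexiveTransitive using (ε; _◅_; _◅◅_)
open import Relation.Binary.PropositionalEquality
open import Relation.Nullary using (¬_; yes; no; contradiction; Reflects; invert; proof)
open import Relation.Nullary.Decidable using (dec-true; ¬?; _×-dec_)

open LabelledDigraph

-- Counting along injective relations between lists.

module _ {A : Set} where

  ∈⇒↭∷ : ∀ {x : A} {xs} → x List.∈ xs → ∃ λ ys → xs ↭ x ∷ ys
  ∈⇒↭∷ x∈xs with ys , zs , refl ← ∈-∃++ x∈xs = ys ++ zs , shift _ ys zs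

  Unique-resp-↭ : ∀ {xs ys : List A} → xs ↭ ys → Unique xs → Unique ys
  Unique-resp-↭ p = Permutation.Unique-resp-↭ (setoid A) (↭⇒↭ₛ p)

  module _ {B : Set} {f : A → B} where

    Unique-map⁺ : ∀ {xs} → (∀ {x y} → x List.∈ xs → y List.∈ xs → f x ≡ f y → x ≡ y) →
                  Unique xs → Unique (map f xs)
    Unique-map⁺ inj [] = []
    Unique-map⁺ {x ∷ xs} inj (x∉xs ∷ u) =
      All.tabulate (λ y∈ fx≡y → let z , z∈xs , y≡fz = ∈-map⁻ f y∈ in
        All.lookup x∉xs z∈xs (inj (here refl) (there z∈xs) (trans fx≡y y≡fz)))
      ∷ Unique-map⁺ (λ x∈ y∈ → inj (there x∈) (there y∈)) u

    Unique-map⁻ : ∀ {xs} → Unique (map f xs) →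
                  ∀ {x y} → x List.∈ xs → y List.∈ xs → f x ≡ f y → x ≡ y
    Unique-map⁻ (_ ∷ _)  (here refl) (here refl) _  = refl
    Unique-map⁻ (fx∉ ∷ _) (here refl) (there y∈) eq = contradiction eq (All.lookup fx∉ (∈-map⁺ f y∈))
    Unique-map⁻ (fy∉ ∷ _) (there x∈) (here refl) eq = contradiction (sym eq) (All.lookup fy∉ (∈-map⁺ f x∈))
    Unique-map⁻ (_ ∷ u) (there x∈) (there y∈) eq    = Unique-map⁻ u x∈ y∈ eq

module _ {A B : Set} {R : A → B → Set} (R-injective : ∀ {x x′ y} → R x y → R x′ y → x ≡ x′) where

  -- The partner of the head is removed from `ys`; by injectivity no later element can have chosen
  -- it. A relation is used instead of a function because the partner is extracted from a membership
  -- proof.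
  injection⇒length≤ : ∀ {xs ys} → Unique xs → (∀ {x} → x List.∈ xs → ∃ λ y → y List.∈ ys × R x y) →
                      length xs ≤ length ys
  injection⇒length≤ {[]} _ _ = z≤n
  injection⇒length≤ {x ∷ xs} {ys} (x∉xs ∷ u) R-total
    with y , y∈ys , Rxy ← R-total (here refl)
    with zs , ys↭y∷zs ← ∈⇒↭∷ y∈ys
    rewrite ↭-length ys↭y∷zs = s≤s (injection⇒length≤ u total′)
    where
    total′ : ∀ {x′} → x′ List.∈ xs → ∃ λ y′ → y′ List.∈ zs × R x′ y′
    total′ x′∈xs with y′ , y′∈ys , Rx′y′ ← R-total (there x′∈xs) with ∈-resp-↭ ys↭y∷zs y′∈ys
    ... | here refl   = contradiction (R-injective Rxy Rx′y′) (All.lookup x∉xs x′∈xs)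
    ... | there y′∈zs = y′ , y′∈zs , Rx′y′

  -- Whoever is sent to `y₀` can be rerouted, so `xs` still injects into `ys` with `y₀` removed.
  injection⇒length< : ∀ {xs ys y₀} → Unique xs → (∀ {x} → x List.∈ xs → ∃ λ y → y List.∈ ys × R x y) →
                      y₀ List.∈ ys → (∀ {x} → R x y₀ → ∃ λ y → y List.∈ ys × R x y × y ≢ y₀) →
                      length xs < length ys
  injection⇒length< {xs} {ys} {y₀} u R-total y₀∈ys avoid
    with zs , ys↭y₀∷zs ← ∈⇒↭∷ y₀∈ys
    rewrite ↭-length ys↭y₀∷zs = s≤s (injection⇒length≤ u total′)
    where
    total′ : ∀ {x} → x List.∈ xs → ∃ λ y → y List.∈ zs × R x y
    total′ x∈xs with y , y∈ys , Rxy ← R-total x∈xs with ∈-resp-↭ ys↭y₀∷zs y∈ys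
    ... | there y∈zs = y , y∈zs , Rxy
    ... | here refl with z , z∈ys , Rxz , z≢y₀ ← avoid Rxy with ∈-resp-↭ ys↭y₀∷zs z∈ys
    ...   | here z≡y₀  = contradiction z≡y₀ z≢y₀
    ...   | there z∈zs = z , z∈zs , Rxz

Unique∧⊆⇒length≤ : ∀ {A : Set} {xs ys : List A} → Unique xs → (∀ {x} → x List.∈ xs → x List.∈ ys) →
                   length xs ≤ length ys
Unique∧⊆⇒length≤ u xs⊆ys = injection⇒length≤ {R = _≡_} (λ p q → trans p (sym q)) u
  λ x∈xs → _ , xs⊆ys x∈xs , refl

m-n≡1⇔n+1≡m : ∀ m n → (ℤ.+ m ℤ.- ℤ.+ n ≡ 1ℤ) ⇔ (n + 1 ≡ m)
m-n≡1⇔n+1≡m m n = mk⇔ to from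
  where
  open ≡-Reasoning
  to : ℤ.+ m ℤ.- ℤ.+ n ≡ 1ℤ → n + 1 ≡ m
  to eq = ℤ.+-injective (begin
    ℤ.+ (n + 1)                              ≡⟨ cong ℤ.+_ (ℕ.+-comm n 1) ⟩
    1ℤ ℤ.+ ℤ.+ n                             ≡⟨ cong (ℤ._+ ℤ.+ n) eq ⟨
    ℤ.+ m ℤ.- ℤ.+ n ℤ.+ ℤ.+ n                ≡⟨ ℤ.+-assoc (ℤ.+ m) (ℤ.- ℤ.+ n) (ℤ.+ n) ⟩
    ℤ.+ m ℤ.+ (ℤ.- ℤ.+ n ℤ.+ ℤ.+ n)          ≡⟨ cong (ℤ._+_ (ℤ.+ m)) (ℤ.+-inverseˡ (ℤ.+ n)) ⟩
    ℤ.+ m ℤ.+ ℤ.0ℤ                           ≡⟨ ℤ.+-identityʳ (ℤ.+ m) ⟩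
    ℤ.+ m                                    ∎)
  from : n + 1 ≡ m → ℤ.+ m ℤ.- ℤ.+ n ≡ 1ℤ
  from refl = begin
    ℤ.+ (n + 1) ℤ.- ℤ.+ n                    ≡⟨ cong (λ k → ℤ.+ k ℤ.- ℤ.+ n) (ℕ.+-comm n 1) ⟩
    1ℤ ℤ.+ ℤ.+ n ℤ.- ℤ.+ n                   ≡⟨ ℤ.+-assoc 1ℤ (ℤ.+ n) (ℤ.- ℤ.+ n) ⟩
    1ℤ ℤ.+ (ℤ.+ n ℤ.- ℤ.+ n)                 ≡⟨ cong (ℤ._+_ 1ℤ) (ℤ.+-inverseʳ (ℤ.+ n)) ⟩
    1ℤ                                       ∎

≢∧≢⇒≡ : ∀ {a b c : Bool} → a ≢ c → b ≢ c → a ≡ b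
≢∧≢⇒≡ a≢c b≢c = trans (¬-not a≢c) (sym (¬-not b≢c))

-- Subsets as lists and as bit vectors.

private
  variable
    n : ℕ
    A B C D Y Z r v w : Subset n
    x y z : Fin n

-- Turns a cardinality into the length of a list, so that the counting lemmas apply to `ess F`.
elements : Subset n → List (Fin n)
elements []            = []
elements (inside ∷ A)  = zero ∷ map suc (elements A)
elements (outside ∷ A) = map suc (elements A)

length-elements : ∀ (A : Subset n) → length (elements A) ≡ ∣ A ∣
length-elements []            = refl
length-elements (inside ∷ A)  = cong suc (trans (length-map suc (elements A)) (length-elements A))
length-elements (outside ∷ A) = trans (length-map suc (elements A)) (length-elements A)

∈-elements⁺ : x ∈ A → x List.∈ elements A
∈-elements⁺ {A = inside ∷ A} Vec.here = here refl
∈-elements⁺ {A = inside ∷ A} (Vec.there x∈A) = there (∈-map⁺ suc (∈-elements⁺ x∈A))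
∈-elements⁺ {A = outside ∷ A} (Vec.there x∈A) = ∈-map⁺ suc (∈-elements⁺ x∈A)

∈-elements⁻ : x List.∈ elements A → x ∈ A
∈-elements⁻ {A = inside ∷ A} (here refl) = Vec.here
∈-elements⁻ {A = inside ∷ A} (there x∈) with _ , y∈ , refl ← ∈-map⁻ suc x∈ = Vec.there (∈-elements⁻ y∈)
∈-elements⁻ {A = outside ∷ A} x∈ with _ , y∈ , refl ← ∈-map⁻ suc x∈ = Vec.there (∈-elements⁻ y∈)

elements-unique : ∀ (A : Subset n) → Unique (elements A)
elements-unique []            = []
elements-unique (inside ∷ A)  =
  All.tabulate (λ x∈ → λ { refl → case (∈-map⁻ suc x∈) })
  ∷ Unique.map⁺ Fin.suc-injective (elements-unique A)
  where
  case : ¬ (∃ λ y → y List.∈ elements A × zero ≡ suc y)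
  case (_ , _ , ())
elements-unique (outside ∷ A) = Unique.map⁺ Fin.suc-injective (elements-unique A)

lookup⇒∈ : lookup A x ≡ true → x ∈ A
lookup⇒∈ = lookup⇒[]= _ _

∉⇒lookup : x ∉ A → lookup A x ≡ false
∉⇒lookup x∉A = ¬-not (x∉A ∘ lookup⇒∈)

lookup⇒∉ : lookup A x ≡ false → x ∉ A
lookup⇒∉ eq x∈A with () ← trans (sym ([]=⇒lookup x∈A)) eq

lookup-ext : (∀ x → lookup A x ≡ lookup B x) → A ≡ B
lookup-ext {A = A} {B} eq = trans (sym (tabulate∘lookup A)) (trans (tabulate-cong eq) (tabulate∘lookup B))

≢⇒lookup≢ : A ≢ B → ∃ λ x → lookup A x ≢ lookup B x
≢⇒lookup≢ {A = A} {B} A≢B = Fin.¬∀⟶∃¬ _ _ (λ x → lookup A x 𝔹.≟ lookup B x) (A≢B ∘ lookup-ext)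

lookup-△ : ∀ (A B : Subset n) x → lookup (A △ B) x ≡ lookup A x xor lookup B x
lookup-△ (inside  ∷ A) (inside  ∷ B) zero = refl
lookup-△ (inside  ∷ A) (outside ∷ B) zero = refl
lookup-△ (outside ∷ A) (inside  ∷ B) zero = refl
lookup-△ (outside ∷ A) (outside ∷ B) zero = refl
lookup-△ (_ ∷ A) (_ ∷ B) (suc x) = lookup-△ A B x

∈△⇒lookup≢ : ∀ (A B : Subset n) → x ∈ A △ B → lookup A x ≢ lookup B x
∈△⇒lookup≢ {x = x} A B x∈ eq
  with () ← trans (sym ([]=⇒lookup x∈))
                  (trans (lookup-△ A B x) (trans (cong (_xor lookup B x) eq) (𝔹.xor-same (lookup B x))))

lookup≢⇒∈△ : ∀ (A B : Subset n) → lookup A x ≢ lookup B x → x ∈ A △ B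
lookup≢⇒∈△ {x = x} A B A≢B = lookup⇒∈ (begin
  lookup (A △ B) x                      ≡⟨ lookup-△ A B x ⟩
  lookup A x xor lookup B x             ≡⟨ cong (_xor lookup B x) (¬-not A≢B) ⟩
  not (lookup B x) xor lookup B x       ≡⟨ 𝔹.not-distribˡ-xor (lookup B x) _ ⟨
  not (lookup B x xor lookup B x)       ≡⟨ cong not (𝔹.xor-same (lookup B x)) ⟩
  true                                  ∎)
  where open ≡-Reasoning

△-self : ∀ (A : Subset n) → A △ A ≡ ⊥
△-self A = lookup-ext λ x →
  trans (lookup-△ A A x) (trans (𝔹.xor-same (lookup A x)) (sym (lookup-replicate x outside)))

△-comm : ∀ (A B : Subset n) → A △ B ≡ B △ A
△-comm A B = lookup-ext λ x →
  trans (lookup-△ A B x) (trans (𝔹.xor-comm (lookup A x) _) (sym (lookup-△ B A x)))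

△-involutive : ∀ (A C : Subset n) → C △ A △ A ≡ C
△-involutive A C = lookup-ext λ x → begin
  lookup (C △ A △ A) x                     ≡⟨ lookup-△ (C △ A) A x ⟩
  lookup (C △ A) x xor lookup A x          ≡⟨ cong (_xor lookup A x) (lookup-△ C A x) ⟩
  (lookup C x xor lookup A x) xor lookup A x ≡⟨ 𝔹.xor-assoc (lookup C x) _ _ ⟩
  lookup C x xor (lookup A x xor lookup A x) ≡⟨ cong (lookup C x xor_) (𝔹.xor-same (lookup A x)) ⟩
  lookup C x xor false                     ≡⟨ 𝔹.xor-identityʳ _ ⟩
  lookup C x                               ∎
  where open ≡-Reasoning

lookup-△-congʳ : ∀ (A B S : Subset n) → lookup A x ≡ lookup B x → lookup (A △ S) x ≡ lookup (B △ S) x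
lookup-△-congʳ {x = x} A B S eq =
  trans (lookup-△ A S x) (trans (cong (_xor lookup S x) eq) (sym (lookup-△ B S x)))

lookup-△-cancelʳ : ∀ (A B S : Subset n) → lookup (A △ S) x ≡ lookup (B △ S) x → lookup A x ≡ lookup B x
lookup-△-cancelʳ {x = x} A B S eq = subst₂ (λ P Q → lookup P x ≡ lookup Q x)
  (△-involutive S A) (△-involutive S B) (lookup-△-congʳ (A △ S) (B △ S) S eq)

-- Bit flips, Hamming distance and edges of the cube.

infixl 7 _⊕_

-- An undirected edge labelled `x` is a pair `A`, `A ⊕ x`, whichever end is the smaller set;
-- `lookup A x` recovers the direction.
_⊕_ : Subset n → Fin n → Subset n
A ⊕ x = A [ x ]%= not

lookup-⊕-≡ : ∀ (A : Subset n) x → lookup (A ⊕ x) x ≡ not (lookup A x)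
lookup-⊕-≡ A x = lookup∘updateAt x A

lookup-⊕-≢ : ∀ (A : Subset n) → y ≢ x → lookup (A ⊕ x) y ≡ lookup A y
lookup-⊕-≢ A y≢x = lookup∘updateAt′ _ _ y≢x A

lookup-⊕≢ : ∀ (A : Subset n) x → lookup (A ⊕ x) x ≢ lookup A x
lookup-⊕≢ A x eq = not-¬ refl (trans (sym eq) (lookup-⊕-≡ A x))

⊕-involutive : ∀ (A : Subset n) x → A ⊕ x ⊕ x ≡ A
⊕-involutive A x = trans (updateAt-updateAt x A) (updateAt-id-local x A (not-involutive _))

⊕-injectiveˡ : A ⊕ x ≡ B ⊕ x → A ≡ B
⊕-injectiveˡ {A = A} {x} {B} eq = trans (sym (⊕-involutive A x)) (trans (cong (_⊕ x) eq) (⊕-involutive B x))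

⊕-△ : ∀ (A B : Subset n) x → (A ⊕ x) △ B ≡ (A △ B) ⊕ x
⊕-△ (inside  ∷ A) (inside  ∷ B) zero = refl
⊕-△ (inside  ∷ A) (outside ∷ B) zero = refl
⊕-△ (outside ∷ A) (inside  ∷ B) zero = refl
⊕-△ (outside ∷ A) (outside ∷ B) zero = refl
⊕-△ (a ∷ A) (b ∷ B) (suc x) = cong (_ ∷_) (⊕-△ A B x)

∣⊕∣-∉ : ∀ (A : Subset n) x → lookup A x ≡ false → ∣ A ⊕ x ∣ ≡ suc ∣ A ∣
∣⊕∣-∉ (outside ∷ A) zero    refl = refl
∣⊕∣-∉ (inside  ∷ A) (suc x) eq   = cong suc (∣⊕∣-∉ A x eq)
∣⊕∣-∉ (outside ∷ A) (suc x) eq   = ∣⊕∣-∉ A x eq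

∪⁅⁆≡⊕ : x ∉ A → A ∪ ⁅ x ⁆ ≡ A ⊕ x
∪⁅⁆≡⊕ {x = zero} {inside ∷ A} x∉A = contradiction Vec.here x∉A
∪⁅⁆≡⊕ {x = zero} {outside ∷ A} x∉A = cong (inside ∷_) (∪-identityʳ A)
∪⁅⁆≡⊕ {x = suc x} {a ∷ A} x∉A = cong₂ _∷_ (∨-identityʳ a) (∪⁅⁆≡⊕ (x∉A ∘ Vec.there))

∣△∣-agree : ∀ (A B : Subset n) {x} → lookup A x ≡ lookup B x → ∣ (A ⊕ x) △ B ∣ ≡ suc ∣ A △ B ∣
∣△∣-agree A B {x} eq = trans (cong ∣_∣ (⊕-△ A B x)) (∣⊕∣-∉ (A △ B) x
  (∉⇒lookup λ x∈ → ∈△⇒lookup≢ A B x∈ eq))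

∣△∣-differ : ∀ (A B : Subset n) {x} → lookup A x ≢ lookup B x → ∣ A △ B ∣ ≡ suc ∣ (A ⊕ x) △ B ∣
∣△∣-differ A B {x} A≢B = trans (cong (λ S → ∣ S △ B ∣) (sym (⊕-involutive A x)))
  (∣△∣-agree (A ⊕ x) B (≢∧≢⇒≡ (lookup-⊕≢ A x) (A≢B ∘ sym)))

-- Shattering is handled through single bits from here on: only those in `Y` have to be compared,
-- since both sides vanish off `Y`.
∩≡⁺ : ∀ (A : Subset n) → Z ⊆ Y → (∀ {z} → z ∈ Y → lookup A z ≡ lookup Z z) → A ∩ Y ≡ Z
∩≡⁺ {Z = Z} {Y} A Z⊆Y eq = lookup-ext λ z → trans (lookup-zipWith _∧_ z A Y) (bits z)
  where
  bits : ∀ z → lookup A z ∧ lookup Y z ≡ lookup Z z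
  bits z with z ∈? Y
  ... | yes z∈Y = trans (cong (lookup A z ∧_) ([]=⇒lookup z∈Y)) (trans (∧-identityʳ _) (eq z∈Y))
  ... | no  z∉Y = trans (cong (lookup A z ∧_) (∉⇒lookup z∉Y))
                        (trans (∧-zeroʳ _) (sym (∉⇒lookup (z∉Y ∘ Z⊆Y))))

∩≡⁻ : A ∩ Y ≡ Z → x ∈ Y → lookup A x ≡ lookup Z x
∩≡⁻ {A = A} {Y} {x = x} refl x∈Y = sym (trans (lookup-zipWith _∧_ x A Y)
  (trans (cong (lookup A x ∧_) ([]=⇒lookup x∈Y)) (∧-identityʳ _)))

-- `A` and `A ⊕ x` yield the same triple, so an edge can be named from either end.
edgeAt : ∀ {n} → Subset n → Fin n → Subset n × Fin n × Subset n
edgeAt A x = A [ x ]≔ outside , x , A [ x ]≔ inside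

[]≔-not : ∀ (A : Subset n) {x b} → lookup A x ≡ not b → A [ x ]≔ b ≡ A ⊕ x
[]≔-not A {x} eq = updateAt-cong-local x A (sym (trans (cong not eq) (not-involutive _)))

edgeAt-outside : ∀ (A : Subset n) {x} → lookup A x ≡ false → edgeAt A x ≡ (A , x , A ⊕ x)
edgeAt-outside A {x} eq = cong₂ (λ S T → S , x , T)
  (trans (cong (A [ x ]≔_) (sym eq)) ([]≔-lookup A x)) ([]≔-not A eq)

edgeAt-inside : ∀ (A : Subset n) {x} → lookup A x ≡ true → edgeAt A x ≡ (A ⊕ x , x , A)
edgeAt-inside A {x} eq = cong₂ (λ S T → S , x , T)
  ([]≔-not A eq) (trans (cong (A [ x ]≔_) (sym eq)) ([]≔-lookup A x))

-- The triple forgets only the bit at `x`, and the second hypothesis restores it.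
edgeAt-injective : edgeAt A x ≡ edgeAt B x → lookup A x ≡ lookup B x → A ≡ B
edgeAt-injective {A = A} {x} {B} e≡ eq = begin
  A                                    ≡⟨ []≔-lookup A x ⟨
  A [ x ]≔ lookup A x                  ≡⟨ []≔-idempotent A x ⟨
  A [ x ]≔ outside [ x ]≔ lookup A x   ≡⟨ cong₂ (_[ x ]≔_) (cong proj₁ e≡) eq ⟩
  B [ x ]≔ outside [ x ]≔ lookup B x   ≡⟨ []≔-idempotent B x ⟩
  B [ x ]≔ lookup B x                  ≡⟨ []≔-lookup B x ⟩
  B                                    ∎
  where open ≡-Reasoning

-- The common condition and the notions used to reach it.

module _ (F : SetSystem n) where

  -- Distinctness of labels for undirected edges: `A` and `B` are ends of edges labelled `x` that
  -- lie on the same side, which may be either one.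
  OneEdgePerLabel : Set
  OneEdgePerLabel = ∀ {A B x} → A ∈ᶠ F → A ⊕ x ∈ᶠ F → B ∈ᶠ F → B ⊕ x ∈ᶠ F →
                    lookup A x ≡ lookup B x → A ≡ B

  -- Walks whose every step moves closer to the target in the Hamming metric.
  data Geodesic : Subset n → Subset n → Set where
    done : Geodesic A A
    step : A ∈ᶠ F → A ⊕ x ∈ᶠ F → lookup A x ≢ lookup B x → Geodesic (A ⊕ x) B → Geodesic A B

  Isometric : Set
  Isometric = ∀ {A B} → A ∈ᶠ F → B ∈ᶠ F → Geodesic A B

  -- For `x ≢ y` this is shattering of the pair of `x` and `y`, in terms of bits.
  AllPatterns : Fin n → Fin n → Set
  AllPatterns x y = ∀ a b → ∃ λ A → A ∈ᶠ F × lookup A x ≡ a × lookup A y ≡ b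

  record Treelike : Set where
    constructor treelike
    field
      isometric : Isometric
      one       : OneEdgePerLabel

  -- The edge at `v` labelled `y` leads one step nearer to `r` in the Hamming metric. With `r` as
  -- root of a tree, it leads to the parent of `v`.
  Descent : Subset n → Subset n → Fin n → Set
  Descent r v y = v ∈ᶠ F × v ⊕ y ∈ᶠ F × lookup v y ≢ lookup r y

  UniqueDescent : Set
  UniqueDescent = ∀ {r v y z} → r ∈ᶠ F → Descent r v y → Descent r v z → y ≡ z

open Treelike

-- Edges, walks and cycles of the one-inclusion graph.

module _ {F : SetSystem n} where

  private
    G = oneInclusionGraph F

  ∈-edges⁻ : ∀ {s l t} → (s , l , t) List.∈ edges G →
             s ∈ᶠ F × s ⊕ l ∈ᶠ F × lookup s l ≡ false × t ≡ s ⊕ l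
  ∈-edges⁻ e∈
    with c∈ , l∉s , t≡ ← ∈-filter⁻ isInclusionEdge? {xs = _} e∈
    with s∈ , lt∈ ← ∈-cartesianProduct⁻ (members F) _ c∈
    with _ , t∈ ← ∈-cartesianProduct⁻ (allFin n) (members F) lt∈
    with refl ← trans t≡ (∪⁅⁆≡⊕ l∉s)
    = s∈ , t∈ , ∉⇒lookup l∉s , refl

  ∈-edges⁺ : A ∈ᶠ F → A ⊕ x ∈ᶠ F → edgeAt A x List.∈ edges G
  ∈-edges⁺ {A} {x} A∈ Ax∈ with lookup A x in eq
  ... | false = subst (List._∈ edges G) (sym (edgeAt-outside A eq)) (∈-filter⁺ isInclusionEdge?
    (∈-cartesianProduct⁺ A∈ (∈-cartesianProduct⁺ (∈-allFin x) Ax∈))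
    (lookup⇒∉ eq , sym (∪⁅⁆≡⊕ (lookup⇒∉ eq))))
  ... | true  = subst (List._∈ edges G) (sym (edgeAt-inside A eq)) (∈-filter⁺ isInclusionEdge?
    (∈-cartesianProduct⁺ Ax∈ (∈-cartesianProduct⁺ (∈-allFin x) A∈))
    (x∉ , trans (sym (⊕-involutive A x)) (sym (∪⁅⁆≡⊕ x∉))))
    where
    x∉ : x ∉ A ⊕ x
    x∉ = lookup⇒∉ (trans (lookup-⊕-≡ A x) (cong not eq))

  Adjacent⁺ : A ∈ᶠ F → A ⊕ x ∈ᶠ F → Adjacent G A (A ⊕ x)
  Adjacent⁺ {A} {x} A∈ Ax∈ with lookup A x in eq
  ... | false = x , inj₁ (subst (List._∈ edges G) (edgeAt-outside A eq) (∈-edges⁺ A∈ Ax∈))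
  ... | true  = x , inj₂ (subst (List._∈ edges G) (edgeAt-inside A eq) (∈-edges⁺ A∈ Ax∈))

  Adjacent⁻ : Adjacent G A B → ∃ λ x → A ∈ᶠ F × A ⊕ x ∈ᶠ F × B ≡ A ⊕ x
  Adjacent⁻ (x , inj₁ e∈) with s∈ , t∈ , _ , refl ← ∈-edges⁻ e∈ = x , s∈ , t∈ , refl
  Adjacent⁻ (x , inj₂ e∈) with s∈ , t∈ , _ , refl ← ∈-edges⁻ e∈ =
    x , t∈ , subst (_∈ᶠ F) (sym (⊕-involutive _ x)) s∈ , sym (⊕-involutive _ x)

  DistinctLabels⇒OneEdgePerLabel : DistinctLabels G → OneEdgePerLabel F
  DistinctLabels⇒OneEdgePerLabel distinct A∈ Ax∈ B∈ Bx∈ =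
    edgeAt-injective (Unique-map⁻ distinct (∈-edges⁺ A∈ Ax∈) (∈-edges⁺ B∈ Bx∈) refl)

  OneEdgePerLabel⇒label-injective : OneEdgePerLabel F → ∀ {e e′} →
    e List.∈ edges G → e′ List.∈ edges G → label e ≡ label e′ → e ≡ e′
  OneEdgePerLabel⇒label-injective one {_ , l , _} e∈ e′∈ refl
    with s∈ , t∈ , eq , refl ← ∈-edges⁻ e∈ | s′∈ , t′∈ , eq′ , refl ← ∈-edges⁻ e′∈
    with refl ← one s∈ t∈ s′∈ t′∈ (trans eq (sym eq′)) = refl

  OneEdgePerLabel⇒DistinctLabels : OneEdgePerLabel F → DistinctLabels G
  OneEdgePerLabel⇒DistinctLabels one = Unique-map⁺ (OneEdgePerLabel⇒label-injective one) (edges-unique G)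

  -- A coordinate in which the ends differ must flip somewhere; `C` is the vertex just before the
  -- first flip. The splitting of `starts` serves to find repeated vertices on cycles.
  walk-crosses : (w : Walk G A B) → lookup A x ≢ lookup B x →
    ∃ λ C → Σ (Walk G A C) λ p → Σ (Walk G (C ⊕ x) B) λ q →
    C ∈ᶠ F × C ⊕ x ∈ᶠ F × lookup C x ≡ lookup A x × starts G w ≡ starts G p ++ C ∷ starts G q
  walk-crosses ε A≢B = contradiction refl A≢B
  walk-crosses {A} {x = x} (adj ◅ w) A≢B
    with y , A∈ , Ay∈ , refl ← Adjacent⁻ adj
    with x Fin.≟ y
  ... | yes refl = A , ε , w , A∈ , Ay∈ , refl , refl
  ... | no x≢y
    with C , p , q , C∈ , Cx∈ , C≡ , eq ← walk-crosses w (A≢B ∘ trans (sym (lookup-⊕-≢ A x≢y)))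
    = C , adj ◅ p , q , C∈ , Cx∈ , trans C≡ (lookup-⊕-≢ A x≢y) , cong (A ∷_) eq

  length-starts : ∀ (w : Walk G A B) → walkLength G w ≡ length (starts G w)
  length-starts ε       = refl
  length-starts (_ ◅ w) = cong suc (length-starts w)

  starts-first : ∀ (w : Walk G A B) → starts G w ≡ [] ⊎ A List.∈ starts G w
  starts-first ε       = inj₁ refl
  starts-first (_ ◅ _) = inj₂ (here refl)

  -- A closed walk must cross the label of its first edge again, hence return along that edge.
  OneEdgePerLabel⇒acyclic : OneEdgePerLabel F → ¬ Cycle G
  OneEdgePerLabel⇒acyclic one (v , adj ◅ w , 3≤ , unique@(_ ∷ unique′))
    with x , v∈ , vx∈ , refl ← Adjacent⁻ adj
    with C , p , q , C∈ , Cx∈ , C≡ , eq ← walk-crosses {x = x} w (lookup-⊕≢ v x)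
    with refl ← one C∈ Cx∈ vx∈ (subst (_∈ᶠ F) (sym (⊕-involutive v x)) v∈) C≡
    -- A nonempty `p` repeats `v ⊕ x`, a nonempty `q` repeats `v`, and if both are empty the closed
    -- walk has length 2.
    with starts-first p | starts-first q
  ... | inj₂ vx∈p | _ = Unique.Unique[x∷xs]⇒x∉xs
    (Unique-resp-↭ (shift _ (starts G p) _) (subst Unique eq unique′)) (∈-++⁺ˡ vx∈p)
  ... | inj₁ _ | inj₂ v∈q = Unique.Unique[x∷xs]⇒x∉xs unique
    (subst (v List.∈_) (sym eq)
      (∈-++⁺ʳ (starts G p) (there (subst (List._∈ starts G q) (⊕-involutive v x) v∈q))))
  ... | inj₁ p≡[] | inj₁ q≡[] = ℕ.<-irrefl (cong suc (begin-equality
    1                                             ≡⟨ cong₂ (λ xs ys → length (xs ++ v ⊕ x ∷ ys)) p≡[] q≡[] ⟨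
    length (starts G p ++ v ⊕ x ∷ starts G q)     ≡⟨ cong length eq ⟨
    length (starts G w)                           ≡⟨ length-starts w ⟨
    walkLength G w                                ∎)) 3≤
    where open ℕ.≤-Reasoning

  -- Walks compared with Hamming geodesics.

  ∣△∣≤walkLength : ∀ (w : Walk G A B) → ∣ A △ B ∣ ≤ walkLength G w
  ∣△∣≤walkLength {A} ε = ℕ.≤-reflexive (trans (cong ∣_∣ (△-self A)) (∣⊥∣≡0 n))
  ∣△∣≤walkLength {A} {B} (adj ◅ w) with x , _ , _ , refl ← Adjacent⁻ adj with lookup A x 𝔹.≟ lookup B x
  ... | yes A≡B = ℕ.m≤n⇒m≤1+n (ℕ.<⇒≤ (subst (_≤ walkLength G w) (∣△∣-agree A B A≡B) (∣△∣≤walkLength w)))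
  ... | no  A≢B = subst (_≤ suc (walkLength G w)) (sym (∣△∣-differ A B A≢B)) (s≤s (∣△∣≤walkLength w))

  -- Each step changes the Hamming distance to the target by one. After a step away from the target,
  -- the rest of the walk would be too short to arrive.
  shortest⇒Geodesic : (w : Walk G A B) → walkLength G w ≡ ∣ A △ B ∣ → Geodesic F A B
  shortest⇒Geodesic ε _ = done
  shortest⇒Geodesic {A} {B} (adj ◅ w) len≡
    with x , A∈ , Ax∈ , refl ← Adjacent⁻ adj with lookup A x 𝔹.≟ lookup B x
  ... | yes A≡B = contradiction (begin-strict
    walkLength G w            <⟨ ℕ.n<1+n _ ⟩
    suc (walkLength G w)      ≡⟨ len≡ ⟩
    ∣ A △ B ∣                 <⟨ ℕ.n<1+n _ ⟩
    suc ∣ A △ B ∣             ≡⟨ ∣△∣-agree A B A≡B ⟨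
    ∣ (A ⊕ x) △ B ∣           ≤⟨ ∣△∣≤walkLength w ⟩
    walkLength G w            ∎) (ℕ.<-irrefl refl)
    where open ℕ.≤-Reasoning
  ... | no A≢B = step A∈ Ax∈ A≢B (shortest⇒Geodesic w (ℕ.suc-injective (trans len≡ (∣△∣-differ A B A≢B))))

  Geodesic⇒walk : Geodesic F A B → Σ (Walk G A B) λ w → walkLength G w ≡ ∣ A △ B ∣
  Geodesic⇒walk {A} done = ε , sym (trans (cong ∣_∣ (△-self A)) (∣⊥∣≡0 n))
  Geodesic⇒walk {A} {B} (step A∈ Ax∈ A≢B g) with w , len≡ ← Geodesic⇒walk g =
    Adjacent⁺ A∈ Ax∈ ◅ w , trans (cong suc len≡) (sym (∣△∣-differ A B A≢B))

  WellGraded⇒Isometric : WellGraded F → Isometric F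
  WellGraded⇒Isometric wg A∈ B∈ with (w , len≡) , _ ← wg A∈ B∈ = shortest⇒Geodesic w len≡

  Isometric⇒WellGraded : Isometric F → WellGraded F
  Isometric⇒WellGraded iso A∈ B∈ = Geodesic⇒walk (iso A∈ B∈) , ∣△∣≤walkLength

  Isometric⇒Connected : Isometric F → Connected G
  Isometric⇒Connected iso A∈ B∈ = proj₁ (Geodesic⇒walk (iso A∈ B∈))

  -- A geodesic flips only coordinates in which its ends differ, hence the last component: `C` lies
  -- between `A` and `B`.
  Geodesic-crosses : Geodesic F A B → lookup A x ≢ lookup B x →
    ∃ λ C → C ∈ᶠ F × C ⊕ x ∈ᶠ F × lookup C x ≡ lookup A x × Geodesic F (C ⊕ x) B
          × (∀ y → lookup A y ≡ lookup B y → lookup C y ≡ lookup B y)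
  Geodesic-crosses done A≢B = contradiction refl A≢B
  Geodesic-crosses {A} {B} {x} (step {x = y} A∈ Ay∈ Ay≢By g) A≢B with x Fin.≟ y
  ... | yes refl = A , A∈ , Ay∈ , refl , g , λ _ → id
  ... | no x≢y
    with C , C∈ , Cx∈ , C≡ , g′ , between ← Geodesic-crosses g (A≢B ∘ trans (sym (lookup-⊕-≢ A x≢y)))
    = C , C∈ , Cx∈ , trans C≡ (lookup-⊕-≢ A x≢y) , g′ , between′
    where
    between′ : ∀ z → lookup A z ≡ lookup B z → lookup C z ≡ lookup B z
    between′ z eq = between z (trans (lookup-⊕-≢ A λ { refl → Ay≢By eq }) eq)

  -- If the first step moves away from the target, the rest must cross the same edge back,
  -- and the first step can be cut out.
  walk⇒Geodesic : OneEdgePerLabel F → Walk G A B → Geodesic F A B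
  walk⇒Geodesic one ε = done
  walk⇒Geodesic {A} {B} one (adj ◅ w)
    with x , A∈ , Ax∈ , refl ← Adjacent⁻ adj with lookup A x 𝔹.≟ lookup B x
  ... | no  A≢B = step A∈ Ax∈ A≢B (walk⇒Geodesic one w)
  ... | yes A≡B
    with C , C∈ , Cx∈ , C≡ , g , _ ← Geodesic-crosses {x = x} (walk⇒Geodesic one w)
                                       (λ eq → lookup-⊕≢ A x (trans eq (sym A≡B)))
    with refl ← one C∈ Cx∈ Ax∈ (subst (_∈ᶠ F) (sym (⊕-involutive A x)) A∈) C≡
    = subst (λ S → Geodesic F S B) (⊕-involutive A x) g

  Connected⇒Isometric : OneEdgePerLabel F → Connected G → Isometric F
  Connected⇒Isometric one connected A∈ B∈ = walk⇒Geodesic one (connected A∈ B∈)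

  -- Essential elements, shattering and VC-dimension.

  ∈ess⁺ : A ∈ᶠ F → B ∈ᶠ F → lookup A x ≢ lookup B x → x ∈ ess F
  ∈ess⁺ {A} {B} {x} A∈ B∈ A≢B = lookup⇒∈
    (trans (lookup∘tabulate _ x) (dec-true (essential? F x) essential))
    where
    essential : Essential F x
    essential with x ∈? A | x ∈? B
    ... | yes x∈A | no  x∉B = (A , A∈ , x∈A) , B , B∈ , x∉B
    ... | no  x∉A | yes x∈B = (B , B∈ , x∈B) , A , A∈ , x∉A
    ... | yes x∈A | yes x∈B = contradiction (trans ([]=⇒lookup x∈A) (sym ([]=⇒lookup x∈B))) A≢B
    ... | no  x∉A | no  x∉B = contradiction (trans (∉⇒lookup x∉A) (sym (∉⇒lookup x∉B))) A≢B

  ∈ess⁻ : x ∈ ess F → ∀ b → ∃ λ A → A ∈ᶠ F × lookup A x ≡ b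
  ∈ess⁻ {x} x∈ b
    -- `ess F` stores only the Boolean `does`; as it is `true` here, `proof` turns it back into
    -- evidence.
    with (A , A∈ , x∈A) , B , B∈ , x∉B ← invert (subst (Reflects (Essential F x))
           (trans (sym (lookup∘tabulate _ x)) ([]=⇒lookup x∈)) (proof (essential? F x)))
    with b
  ... | true  = A , A∈ , []=⇒lookup x∈A
  ... | false = B , B∈ , ∉⇒lookup x∉B

  Shattered⇒⊆ess : Shattered F Y → Y ⊆ ess F
  Shattered⇒⊆ess {Y} shattered {x} x∈Y
    with A , A∈ , A∩Y≡⊥ ← shattered ⊥⊆
       | B , B∈ , B∩Y≡Y ← shattered id
    = ∈ess⁺ A∈ B∈ λ eq → contradiction (begin
        false        ≡⟨ lookup-replicate x false ⟨
        lookup ⊥ x   ≡⟨ ∩≡⁻ A∩Y≡⊥ x∈Y ⟨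
        lookup A x   ≡⟨ eq ⟩
        lookup B x   ≡⟨ ∩≡⁻ B∩Y≡Y x∈Y ⟩
        lookup Y x   ≡⟨ []=⇒lookup x∈Y ⟩
        true         ∎) λ ()
    where open ≡-Reasoning

  ∈ess⇒Shattered : x ∈ ess F → Shattered F ⁅ x ⁆
  ∈ess⇒Shattered {x} x∈ {Z} Z⊆ with A , A∈ , eq ← ∈ess⁻ x∈ (lookup Z x) =
    A , A∈ , ∩≡⁺ A Z⊆ λ z∈ → subst (λ z → lookup A z ≡ lookup Z z) (sym (x∈⁅y⁆⇒x≡y x z∈)) eq

  -- The prescribed trace is `⊥` updated at `x` and then at `y`; `x ≢ y` keeps the second update
  -- from overwriting the first.
  Shattered⇒AllPatterns : Shattered F Y → x ∈ Y → y ∈ Y → x ≢ y → AllPatterns F x y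
  Shattered⇒AllPatterns {Y} {x} {y} shattered x∈Y y∈Y x≢y a b
    = let A , A∈ , A∩Y≡Z = shattered Z⊆Y in
      A , A∈ , trans (∩≡⁻ A∩Y≡Z x∈Y) (trans (lookup∘update′ x≢y (⊥ [ x ]≔ a) b) (lookup∘update x ⊥ a))
    , trans (∩≡⁻ A∩Y≡Z y∈Y) (lookup∘update y (⊥ [ x ]≔ a) b)
    where
    Z⊆Y : ⊥ [ x ]≔ a [ y ]≔ b ⊆ Y
    Z⊆Y {z} z∈ with z Fin.≟ x | z Fin.≟ y
    ... | yes refl | _        = x∈Y
    ... | no _     | yes refl = y∈Y
    ... | no z≢x   | no z≢y   = contradiction
      (trans (sym ([]=⇒lookup z∈)) (trans (lookup∘update′ z≢y (⊥ [ x ]≔ a) b)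
        (trans (lookup∘update′ z≢x ⊥ a) (lookup-replicate z outside)))) λ ()

  AllPatterns⇒Shattered : AllPatterns F x y → Shattered F (⁅ x ⁆ ∪ ⁅ y ⁆)
  AllPatterns⇒Shattered {x} {y} patterns {Z} Z⊆
    with A , A∈ , eqx , eqy ← patterns (lookup Z x) (lookup Z y) = A , A∈ , ∩≡⁺ A Z⊆ agree
    where
    agree : ∀ {z} → z ∈ ⁅ x ⁆ ∪ ⁅ y ⁆ → lookup A z ≡ lookup Z z
    agree z∈ with x∈p∪q⁻ ⁅ x ⁆ ⁅ y ⁆ z∈
    ... | inj₁ z∈x rewrite x∈⁅y⁆⇒x≡y x z∈x = eqx
    ... | inj₂ z∈y rewrite x∈⁅y⁆⇒x≡y y z∈y = eqy

  VC≤1⇒¬AllPatterns : VCDimensionAtMost 1 F → x ≢ y → ¬ AllPatterns F x y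
  VC≤1⇒¬AllPatterns {x} {y} (d , (_ , bound) , d≤1) x≢y patterns = ℕ.<-irrefl refl (begin
    length (x ∷ y ∷ [])                    ≤⟨ Unique∧⊆⇒length≤ ((x≢y ∷ []) ∷ [] ∷ []) pair⊆ ⟩
    length (elements (⁅ x ⁆ ∪ ⁅ y ⁆))      ≡⟨ length-elements (⁅ x ⁆ ∪ ⁅ y ⁆) ⟩
    ∣ ⁅ x ⁆ ∪ ⁅ y ⁆ ∣                      ≤⟨ bound (AllPatterns⇒Shattered patterns) ⟩
    d                                      ≤⟨ d≤1 ⟩
    1                                      ∎)
    where
    open ℕ.≤-Reasoning
    pair⊆ : ∀ {z} → z List.∈ x ∷ y ∷ [] → z List.∈ elements (⁅ x ⁆ ∪ ⁅ y ⁆)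
    pair⊆ (here refl)         = ∈-elements⁺ (x∈p∪q⁺ (inj₁ (x∈⁅x⁆ x)))
    pair⊆ (there (here refl)) = ∈-elements⁺ (x∈p∪q⁺ {p = ⁅ x ⁆} (inj₂ (x∈⁅x⁆ y)))

  ¬AllPatterns⇒∣Shattered∣≤1 : (∀ {x y} → x ≢ y → ¬ AllPatterns F x y) → Shattered F Y → ∣ Y ∣ ≤ 1
  ¬AllPatterns⇒∣Shattered∣≤1 {Y} none shattered = subst (_≤ 1) (length-elements Y)
    (bound (elements-unique Y) (λ x∈ y∈ → Shattered⇒AllPatterns shattered (∈-elements⁻ x∈) (∈-elements⁻ y∈)))
    where
    bound : ∀ {xs} → Unique xs → (∀ {x y} → x List.∈ xs → y List.∈ xs → x ≢ y → AllPatterns F x y) →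
            length xs ≤ 1
    bound []       _ = z≤n
    bound (_ ∷ []) _ = s≤s z≤n
    bound ((x≢y ∷ _) ∷ _ ∷ _) patterns =
      contradiction (patterns (here refl) (there (here refl)) x≢y) (none x≢y)

  -- `VCDimensionAtMost` asks for the exact dimension: it is 1 if there is an essential element,
  -- whose singleton is then shattered, and 0 otherwise.
  ¬AllPatterns⇒VC≤1 : (∀ {x y} → x ≢ y → ¬ AllPatterns F x y) → VCDimensionAtMost 1 F
  ¬AllPatterns⇒VC≤1 none with nonempty? (ess F)
  ... | yes (x , x∈) = 1
    , ((⁅ x ⁆ , ∈ess⇒Shattered x∈ , ∣⁅x⁆∣≡1 x) , ¬AllPatterns⇒∣Shattered∣≤1 none) , ℕ.≤-refl
  ... | no empty = 0 , ((⊥ , ⊥-shattered , ∣⊥∣≡0 n) , bound) , z≤n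
    where
    ⊥-shattered : Shattered F ⊥
    ⊥-shattered Z⊆⊥ with A , A∈ ← nonempty F = A , A∈ , ∩≡⁺ A Z⊆⊥ λ z∈ → contradiction z∈ ∉⊥
    bound : ∀ {Y} → Shattered F Y → ∣ Y ∣ ≤ 0
    bound shattered = ℕ.≤-trans (p⊆q⇒∣p∣≤∣q∣ (Shattered⇒⊆ess shattered))
      (ℕ.≤-reflexive (trans (cong ∣_∣ (Empty-unique empty)) (∣⊥∣≡0 n)))

  -- Consequences of VC-dimension at most 1 and of extremality.

  separated⇒value : A ∈ᶠ F → B ∈ᶠ F → lookup A x ≢ lookup B x → lookup A y ≡ lookup B y →
                    ∀ a → ∃ λ S → S ∈ᶠ F × lookup S x ≡ a × lookup S y ≡ lookup A y
  separated⇒value {A} {B} {x} A∈ B∈ A≢B A≡B a with lookup A x 𝔹.≟ a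
  ... | yes eq = A , A∈ , eq , refl
  ... | no  ne = B , B∈ , ≢∧≢⇒≡ (A≢B ∘ sym) (ne ∘ sym) , sym A≡B

  -- `A` and `B` show both bits at `x` over one bit at `y`; `C` and `D` show both over the other.
  square⇒AllPatterns : A ∈ᶠ F → B ∈ᶠ F → C ∈ᶠ F → D ∈ᶠ F →
    lookup A x ≢ lookup B x → lookup C x ≢ lookup D x →
    lookup A y ≡ lookup B y → lookup C y ≡ lookup D y → lookup A y ≢ lookup C y → AllPatterns F x y
  square⇒AllPatterns {A} {y = y} A∈ B∈ C∈ D∈ A≢B C≢D A≡B C≡D A≢C a b with b 𝔹.≟ lookup A y
  ... | yes refl = separated⇒value A∈ B∈ A≢B A≡B a
  ... | no b≢ with S , S∈ , Sx , Sy ← separated⇒value C∈ D∈ C≢D C≡D a =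
    S , S∈ , Sx , trans Sy (≢∧≢⇒≡ (A≢C ∘ sym) b≢)

  -- Two edges labelled `x` with distinct ends on the same side differ in some `y ≢ x`, and their
  -- four ends form a square over `x` and `y`.
  VC≤1⇒OneEdgePerLabel : VCDimensionAtMost 1 F → OneEdgePerLabel F
  VC≤1⇒OneEdgePerLabel vc {A} {B} {x} A∈ Ax∈ B∈ Bx∈ A≡B with A ≟ˢ B
  ... | yes eq = eq
  ... | no  A≢B with y , Ay≢By ← ≢⇒lookup≢ A≢B = contradiction
    (square⇒AllPatterns A∈ Ax∈ B∈ Bx∈ (lookup-⊕≢ A x ∘ sym) (lookup-⊕≢ B x ∘ sym)
      (sym (lookup-⊕-≢ A y≢x)) (sym (lookup-⊕-≢ B y≢x)) Ay≢By)
    (VC≤1⇒¬AllPatterns vc (y≢x ∘ sym))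
    where
    y≢x : y ≢ x
    y≢x refl = Ay≢By A≡B

  StronglyShattered⇒edge : StronglyShattered F ⁅ x ⁆ → ∃ λ A → A ∈ᶠ F × A ⊕ x ∈ᶠ F × lookup A x ≡ false
  StronglyShattered⇒edge {x} (T , T⊆ , strong) = T
    , subst (_∈ᶠ F) (∪-identityˡ T) (strong ⊥⊆)
    , subst (_∈ᶠ F) (trans (∪-comm ⁅ x ⁆ T) (∪⁅⁆≡⊕ x∉T)) (strong id)
    , ∉⇒lookup x∉T
    where
    x∉T : x ∉ T
    x∉T x∈T = x∈∁p⇒x∉p (T⊆ x∈T) (x∈⁅x⁆ x)

  edge-from : A ∈ᶠ F → A ⊕ x ∈ᶠ F → ∀ b → ∃ λ C → C ∈ᶠ F × C ⊕ x ∈ᶠ F × lookup C x ≡ b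
  edge-from {A} {x} A∈ Ax∈ b with lookup A x 𝔹.≟ b
  ... | yes eq = A , A∈ , Ax∈ , eq
  ... | no  ne = A ⊕ x , Ax∈ , subst (_∈ᶠ F) (sym (⊕-involutive A x)) A∈
               , ≢∧≢⇒≡ (lookup-⊕≢ A x) (ne ∘ sym)

  -- The VC bound forces C off x to lie between A and B, so both remaining gaps are smaller.
  VC≤1⇒edge-between : VCDimensionAtMost 1 F → A ∈ᶠ F → B ∈ᶠ F → C ∈ᶠ F → C ⊕ x ∈ᶠ F →
    lookup A x ≢ lookup B x → lookup C x ≡ lookup A x →
    ∣ A △ C ∣ < ∣ A △ B ∣ × ∣ (C ⊕ x) △ B ∣ < ∣ A △ B ∣
  VC≤1⇒edge-between {A} {B} {C} {x} vc A∈ B∈ C∈ Cx∈ Ax≢Bx Cx≡Ax =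
      p⊂q⇒∣p∣<∣q∣ (A△C⊆ , x , lookup≢⇒∈△ A B Ax≢Bx , λ x∈ → ∈△⇒lookup≢ A C x∈ (sym Cx≡Ax))
    , p⊂q⇒∣p∣<∣q∣ (Cx△B⊆ , x , lookup≢⇒∈△ A B Ax≢Bx , λ x∈ → ∈△⇒lookup≢ (C ⊕ x) B x∈ Cx≡Bx)
    where
    Cx≡Bx : lookup (C ⊕ x) x ≡ lookup B x
    Cx≡Bx = ≢∧≢⇒≡ (lookup-⊕≢ C x) (Ax≢Bx ∘ λ eq → trans (sym Cx≡Ax) (sym eq))

    -- A disagreement of `A` and `C` at `y` would make `A`, `B`, `C`, `C ⊕ x` a square over `x` and
    -- `y`.
    between : ∀ {y} → y ≢ x → lookup A y ≡ lookup B y → lookup A y ≡ lookup C y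
    between {y} y≢x A≡B with lookup A y 𝔹.≟ lookup C y
    ... | yes eq = eq
    ... | no  ne = contradiction
      (square⇒AllPatterns A∈ B∈ C∈ Cx∈ Ax≢Bx (lookup-⊕≢ C x ∘ sym) A≡B (sym (lookup-⊕-≢ C y≢x)) ne)
      (VC≤1⇒¬AllPatterns vc (y≢x ∘ sym))

    A△C⊆ : A △ C ⊆ A △ B
    A△C⊆ y∈ = lookup≢⇒∈△ A B λ A≡B →
      ∈△⇒lookup≢ A C y∈ (between (λ { refl → Ax≢Bx A≡B }) A≡B)

    Cx△B⊆ : (C ⊕ x) △ B ⊆ A △ B
    Cx△B⊆ y∈ = lookup≢⇒∈△ A B λ A≡B →
      let y≢x = λ { refl → Ax≢Bx A≡B } in
      ∈△⇒lookup≢ (C ⊕ x) B y∈ (trans (lookup-⊕-≢ C y≢x) (trans (sym (between y≢x A≡B)) A≡B))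

  -- The singleton of an essential `x` is shattered; strong shattering yields an edge labelled `x`,
  -- which is entered from the side of `A`.
  Extremal⇒edge : Extremal F → A ∈ᶠ F → B ∈ᶠ F → lookup A x ≢ lookup B x →
    ∃ λ C → C ∈ᶠ F × C ⊕ x ∈ᶠ F × lookup C x ≡ lookup A x
  Extremal⇒edge {A} {x = x} extremal A∈ B∈ Ax≢Bx =
    let strong           = extremal {⁅ x ⁆} (∈ess⇒Shattered (∈ess⁺ A∈ B∈ Ax≢Bx))
        D , D∈ , Dx∈ , _ = StronglyShattered⇒edge strong
    in edge-from D∈ Dx∈ (lookup A x)

  -- The edge found need not touch `A` or `B`, so both gaps around it are filled by recursion on the
  -- Hamming distance.
  Extremal⇒Connected : Extremal F → VCDimensionAtMost 1 F → Connected G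
  Extremal⇒Connected extremal vc = go (<-wellFounded _)
    where
    go : ∀ {A B} → Acc _<_ ∣ A △ B ∣ → A ∈ᶠ F → B ∈ᶠ F → Walk G A B
    go {A} {B} (acc rec) A∈ B∈ with A ≟ˢ B
    ... | yes refl = ε
    ... | no  A≢B =
      let x , Ax≢Bx             = ≢⇒lookup≢ A≢B
          C , C∈ , Cx∈ , Cx≡Ax  = Extremal⇒edge extremal A∈ B∈ Ax≢Bx
          A△C< , Cx△B<          = VC≤1⇒edge-between vc A∈ B∈ C∈ Cx∈ Ax≢Bx Cx≡Ax
      in go (rec A△C<) A∈ C∈ ◅◅ (Adjacent⁺ C∈ Cx∈ ◅ go (rec Cx△B<) Cx∈ B∈)

  -- VC-dimension and extremality from geodesics and distinct labels.

  Isometric⇒edge-between : Isometric F → A ∈ᶠ F → B ∈ᶠ F → lookup A x ≡ false → lookup B x ≡ true →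
    ∃ λ C → C ∈ᶠ F × C ⊕ x ∈ᶠ F × lookup C x ≡ false
        × (∀ y → lookup A y ≡ lookup B y → lookup C y ≡ lookup B y)
  Isometric⇒edge-between {x = x} isometric A∈ B∈ Ax Bx
    with C , C∈ , Cx∈ , Cx≡Ax , _ , between ← Geodesic-crosses {x = x} (isometric A∈ B∈)
           (λ eq → contradiction (trans (sym Ax) (trans eq Bx)) λ ())
    = C , C∈ , Cx∈ , trans Cx≡Ax Ax , between

  -- A geodesic between two members with bit `b` at `y` and different bits at `x` never flips `y`,
  -- so it crosses `x` at that bit of `y`.
  AllPatterns⇒edge : Isometric F → AllPatterns F x y →
    ∀ b → ∃ λ C → C ∈ᶠ F × C ⊕ x ∈ᶠ F × lookup C x ≡ false × lookup C y ≡ b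
  AllPatterns⇒edge {y = y} isometric patterns b
    with A , A∈ , Ax , Ay ← patterns false b | B , B∈ , Bx , By ← patterns true b
    with C , C∈ , Cx∈ , Cx , between ← Isometric⇒edge-between isometric A∈ B∈ Ax Bx
    = C , C∈ , Cx∈ , Cx , trans (between y (trans Ay (sym By))) By

  -- The edges labelled `x` found over the two bits at `y` would be distinct.
  Treelike⇒¬AllPatterns : Treelike F → ¬ AllPatterns F x y
  Treelike⇒¬AllPatterns (treelike isometric one) patterns
    with C , C∈ , Cx∈ , Cx , Cy ← AllPatterns⇒edge isometric patterns true
       | D , D∈ , Dx∈ , Dx , Dy ← AllPatterns⇒edge isometric patterns false
    with refl ← one C∈ Cx∈ D∈ Dx∈ (trans Cx (sym Dx))
    with () ← trans (sym Cy) Dy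

  Treelike⇒VC≤1 : Treelike F → VCDimensionAtMost 1 F
  Treelike⇒VC≤1 tl = ¬AllPatterns⇒VC≤1 λ _ → Treelike⇒¬AllPatterns tl

  Isometric⇒edge : Isometric F → x ∈ ess F → ∃ λ A → A ∈ᶠ F × A ⊕ x ∈ᶠ F × lookup A x ≡ false
  Isometric⇒edge isometric x∈
    with A , A∈ , Ax ← ∈ess⁻ x∈ false | B , B∈ , Bx ← ∈ess⁻ x∈ true
    with C , C∈ , Cx∈ , Cx , _ ← Isometric⇒edge-between isometric A∈ B∈ Ax Bx
    = C , C∈ , Cx∈ , Cx

  -- Since no pair is shattered, `Y` is empty or a singleton. The set `T` is any member in the first
  -- case, and the lower end of an edge with that label in the second.
  Treelike⇒Extremal : Treelike F → Extremal F
  Treelike⇒Extremal tl {Y} shattered with nonempty? Y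
  ... | no empty rewrite Empty-unique empty with A , A∈ ← nonempty F =
    A , (λ _ → x∉p⇒x∈∁p ∉⊥) , λ {Z} Z⊆⊥ →
      subst (_∈ᶠ F) (sym (trans (cong (_∪ A) (⊆-antisym Z⊆⊥ ⊥⊆)) (∪-identityˡ A))) A∈
  ... | yes (x , x∈Y)
    with A , A∈ , Ax∈ , Ax ← Isometric⇒edge (isometric tl) (Shattered⇒⊆ess shattered x∈Y)
    = A , (λ z∈A → x∉p⇒x∈∁p λ z∈Y → lookup⇒∉ Ax (subst (_∈ A) (only z∈Y) z∈A)) , strong
    where
    only : ∀ {z} → z ∈ Y → z ≡ x
    only {z} z∈Y with z Fin.≟ x
    ... | yes eq = eq
    ... | no  ne = contradiction (Shattered⇒AllPatterns shattered z∈Y x∈Y ne) (Treelike⇒¬AllPatterns tl)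

    strong : ∀ {Z} → Z ⊆ Y → Z ∪ A ∈ᶠ F
    strong {Z} Z⊆Y with x ∈? Z
    ... | yes x∈Z = subst (_∈ᶠ F)
      (trans (sym (∪⁅⁆≡⊕ (lookup⇒∉ Ax))) (trans (∪-comm A ⁅ x ⁆) (cong (_∪ A) (sym Z≡)))) Ax∈
      where
      Z≡ : Z ≡ ⁅ x ⁆
      Z≡ = ⊆-antisym (λ z∈ → subst (_∈ ⁅ x ⁆) (sym (only (Z⊆Y z∈))) (x∈⁅x⁆ x))
                     (λ z∈ → subst (_∈ Z) (sym (x∈⁅y⁆⇒x≡y x z∈)) x∈Z)
    ... | no  x∉Z = subst (_∈ᶠ F) (sym (trans (cong (_∪ A) Z≡) (∪-identityˡ A))) A∈
      where
      Z≡ : Z ≡ ⊥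
      Z≡ = Empty-unique λ (z , z∈) → x∉Z (subst (_∈ Z) (only (Z⊆Y z∈)) z∈)

  -- Counting the members other than a root by their descents.

  others : r ∈ᶠ F → ∃ λ vs → size F ≡ length vs + 1 × Unique vs
         × (∀ {v} → v List.∈ vs → v ∈ᶠ F × v ≢ r) × (∀ {v} → v ∈ᶠ F → v ≢ r → v List.∈ vs)
  others {r} r∈ with vs , p ← ∈⇒↭∷ r∈ with u@(_ ∷ u′) ← Unique-resp-↭ p (unique F) =
    vs , trans (↭-length p) (ℕ.+-comm 1 _) , u′
    , (λ v∈ → ∈-resp-↭ (↭-sym p) (there v∈) , λ { refl → Unique.Unique[x∷xs]⇒x∉xs u v∈ })
    , λ v∈ v≢r → tail v≢r (∈-resp-↭ p v∈)
    where
    tail : ∀ {v vs} → v ≢ r → v List.∈ r ∷ vs → v List.∈ vs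
    tail v≢r (here v≡r) = contradiction v≡r v≢r
    tail _   (there v∈) = v∈

  Geodesic⇒Descent : Geodesic F v r → v ≢ r → ∃ (Descent F r v)
  Geodesic⇒Descent done v≢r = contradiction refl v≢r
  Geodesic⇒Descent (step {x = x} v∈ vx∈ ne _) _ = x , v∈ , vx∈ , ne

  Descent⇒≢ : Descent F r v y → v ≢ r
  Descent⇒≢ (_ , _ , ne) refl = ne refl

  Descent⇒∈ess : r ∈ᶠ F → Descent F r v y → y ∈ ess F
  Descent⇒∈ess r∈ (v∈ , _ , ne) = ∈ess⁺ v∈ r∈ ne

  -- Both vertices lie on the side of `x` away from `r`.
  Descent-apex : OneEdgePerLabel F → Descent F r v x → Descent F r w x → v ≡ w
  Descent-apex one (v∈ , vx∈ , v≢) (w∈ , wx∈ , w≢) = one v∈ vx∈ w∈ wx∈ (≢∧≢⇒≡ v≢ w≢)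

  -- Matches essential labels with members other than `r`; uniqueness of the descent makes the
  -- matching injective.
  OnlyDescent : Subset n → Fin n → Subset n → Set
  OnlyDescent r x v = Descent F r v x × (∀ {y} → Descent F r v y → y ≡ x)

  OnlyDescent-injective : OnlyDescent r x v → OnlyDescent r y v → x ≡ y
  OnlyDescent-injective (d , _) (_ , only) = only d

  -- From a member that differs from `r` at `x`, descents other than `x` are followed as long as
  -- there are any; they keep the bit at `x` and approach `r`. Where they run out, isometry still
  -- provides a descent, which must be `x`.
  ∃OnlyDescent : Isometric F → r ∈ᶠ F → x ∈ ess F → ∃ λ v → v ∈ᶠ F × OnlyDescent r x v
  ∃OnlyDescent {r} {x} isometric r∈ x∈ =
    let v , v∈ , eq = ∈ess⁻ x∈ (not (lookup r x))
    in go (<-wellFounded ∣ v △ r ∣) v∈ λ eq′ → not-¬ refl (trans (sym eq′) eq)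
    where
    go : ∀ {v} → Acc _<_ ∣ v △ r ∣ → v ∈ᶠ F → lookup v x ≢ lookup r x → ∃ λ v → v ∈ᶠ F × OnlyDescent r x v
    go {v} (acc rec) v∈ v≢r
      with Fin.any? (λ y → ¬? (y Fin.≟ x) ×-dec DecList._∈?_ _≟ˢ_ (v ⊕ y) (members F)
                          ×-dec ¬? (lookup v y 𝔹.≟ lookup r y))
    ... | yes (y , y≢x , vy∈ , ne) =
      go (rec (ℕ.≤-reflexive (sym (∣△∣-differ v r ne)))) vy∈ (v≢r ∘ trans (sym (lookup-⊕-≢ v (y≢x ∘ sym))))
    ... | no none = v , v∈ , subst (Descent F r v) (only first) first , only
      where
      only : ∀ {y} → Descent F r v y → y ≡ x
      only {y} (_ , vy∈ , ne) with y Fin.≟ x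
      ... | yes eq  = eq
      ... | no  y≢x = contradiction (y , y≢x , vy∈ , ne) none
      first = proj₂ (Geodesic⇒Descent (isometric v∈ r∈) λ { refl → v≢r refl })

  -- With root `A`, the vertex `B ⊕ x` descends along `x` to `B`. If `A ≢ B`, the first step of a
  -- geodesic to `A ⊕ x` is a second descent, with a label other than `x`.
  UniqueDescent⇒OneEdgePerLabel : Isometric F → UniqueDescent F → OneEdgePerLabel F
  UniqueDescent⇒OneEdgePerLabel isometric unique-descent {A} {B} {x} A∈ Ax∈ B∈ Bx∈ A≡B with A ≟ˢ B
  ... | yes eq = eq
  ... | no A≢B
    with y , Bx∈ , Bxy∈ , ne ← Geodesic⇒Descent (isometric Bx∈ Ax∈) (A≢B ∘ sym ∘ ⊕-injectiveˡ)
    = contradiction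
        (unique-descent A∈
          (Bx∈ , Bxy∈ , λ eq → ne (trans eq (sym (lookup-⊕-≢ A y≢x))))
          (Bx∈ , subst (_∈ᶠ F) (sym (⊕-involutive B x)) B∈
               , λ eq → lookup-⊕≢ B x (trans eq A≡B)))
        y≢x
    where
    y≢x : y ≢ x
    y≢x refl = ne (trans (lookup-⊕-≡ B x) (trans (cong not (sym A≡B)) (sym (lookup-⊕-≡ A x))))

  -- A vertex with two descents is missed when every essential label is sent to a vertex
  -- from which it is the only descent.
  ess-count⇒UniqueDescent : Isometric F → ∣ ess F ∣ + 1 ≡ size F → UniqueDescent F
  ess-count⇒UniqueDescent isometric count {r} {v} {y} {z} r∈ dy dz with y Fin.≟ z
  ... | yes eq  = eq
  ... | no  y≢z
    with vs , size≡ , _ , _ , ∈vs ← others r∈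
    = contradiction
        (injection⇒length< {R = OnlyDescent r} (OnlyDescent-injective {r = r}) (elements-unique (ess F))
          total (∈vs (proj₁ dy) (Descent⇒≢ dy))
          λ (_ , only) → contradiction (trans (only dy) (sym (only dz))) y≢z)
        (ℕ.<-irrefl (trans (length-elements (ess F)) (ℕ.+-cancelʳ-≡ 1 _ _ (trans count size≡))))
    where
    total : ∀ {x} → x List.∈ elements (ess F) → ∃ λ v → v List.∈ vs × OnlyDescent r x v
    total x∈ = let v , v∈ , only = ∃OnlyDescent isometric r∈ (∈-elements⁻ x∈) in
      v , ∈vs v∈ (Descent⇒≢ (proj₁ only)) , only

  EdgeTowards : Subset n → Subset n → Subset n × Fin n × Subset n → Set
  EdgeTowards r v e = ∃ λ x → Descent F r v x × edgeAt v x ≡ e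

  EdgeTowards-injective : ∀ {e} → EdgeTowards r v e → EdgeTowards r w e → v ≡ w
  EdgeTowards-injective (x , (_ , _ , v≢) , eq) (y , (_ , _ , w≢) , eq′)
    with refl ← cong label (trans eq (sym eq′)) = edgeAt-injective (trans eq (sym eq′)) (≢∧≢⇒≡ v≢ w≢)

  -- Every vertex other than r has an edge towards r, and these edges are distinct;
  -- a second edge from the same vertex would be one too many.
  edge-count⇒UniqueDescent : Isometric F → size F ≡ edgeCount G + 1 → UniqueDescent F
  edge-count⇒UniqueDescent isometric count {r} {v} {y} {z} r∈ dy@(v∈ , vy∈ , _) dz@(_ , vz∈ , _)
    with y Fin.≟ z
  ... | yes eq  = eq
  ... | no  y≢z
    with vs , size≡ , vs-unique , vs⊆ , _ ← others r∈
    = contradiction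
        (injection⇒length< {R = EdgeTowards r} (EdgeTowards-injective {r = r}) vs-unique
          total (∈-edges⁺ v∈ vy∈) avoid)
        (ℕ.<-irrefl (ℕ.+-cancelʳ-≡ 1 _ _ (trans (sym size≡) count)))
    where
    total : ∀ {w} → w List.∈ vs → ∃ λ e → e List.∈ edges G × EdgeTowards r w e
    total w∈vs =
      let w∈ , w≢r = vs⊆ w∈vs
          x , d@(_ , wx∈ , _) = Geodesic⇒Descent (isometric w∈ r∈) w≢r
      in _ , ∈-edges⁺ w∈ wx∈ , x , d , refl
    avoid : ∀ {w} → EdgeTowards r w (edgeAt v y) →
            ∃ λ e → e List.∈ edges G × EdgeTowards r w e × e ≢ edgeAt v y
    avoid d with refl ← EdgeTowards-injective {r = r} d (y , dy , refl) =
      _ , ∈-edges⁺ v∈ vz∈ , (z , dz , refl) , y≢z ∘ sym ∘ cong label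

  -- Sending a label to a member where it is the only descent gives one inequality. Sending a member
  -- to the label of a descent gives the other, injectively because each label has one edge.
  Treelike⇒size : Treelike F → ∣ ess F ∣ + 1 ≡ size F
  Treelike⇒size (treelike isometric one)
    with r , r∈ ← nonempty F
    with vs , size≡ , vs-unique , vs⊆ , ∈vs ← others r∈
    = trans (cong (_+ 1) (trans (sym (length-elements (ess F))) (ℕ.≤-antisym
        (injection⇒length≤ {R = OnlyDescent r} (OnlyDescent-injective {r = r}) (elements-unique (ess F))
          λ x∈ → let v , v∈ , only = ∃OnlyDescent isometric r∈ (∈-elements⁻ x∈) in
            v , ∈vs v∈ (Descent⇒≢ (proj₁ only)) , only)
        (injection⇒length≤ {R = Descent F r} (Descent-apex {r = r} one) vs-unique λ v∈vs →
          let v∈ , v≢r = vs⊆ v∈vs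
              x , d    = Geodesic⇒Descent (isometric v∈ r∈) v≢r
          in x , ∈-elements⁺ (Descent⇒∈ess r∈ d) , d))))
      (sym size≡)

  -- Edge labels and the number of edges.

  ∈labels⇒∈ess : x List.∈ labels G → x ∈ ess F
  ∈labels⇒∈ess x∈ with (s , _ , _) , e∈ , refl ← ∈-map⁻ label x∈ with s∈ , t∈ , _ , refl ← ∈-edges⁻ e∈ =
    ∈ess⁺ t∈ s∈ (lookup-⊕≢ s _)

  Connected⇒edge : Connected G → x ∈ ess F → ∃ λ A → edgeAt A x List.∈ edges G
  Connected⇒edge {x} connected x∈
    with A , A∈ , Ax ← ∈ess⁻ x∈ false | B , B∈ , Bx ← ∈ess⁻ x∈ true
    with C , _ , _ , C∈ , Cx∈ , _ ← walk-crosses {x = x} (connected A∈ B∈)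
           (λ eq → contradiction (trans (sym Ax) (trans eq Bx)) λ ())
    = C , ∈-edges⁺ C∈ Cx∈

  -- The labels of the edges list `ess F` without repetition: a walk between members that differ at
  -- `x` has an edge labelled `x`.
  Treelike⇒edgeCount : Treelike F → edgeCount G ≡ ∣ ess F ∣
  Treelike⇒edgeCount (treelike isometric one) = begin
    edgeCount G                 ≡⟨ length-map label (edges G) ⟨
    length (labels G)           ≡⟨ ℕ.≤-antisym
      (Unique∧⊆⇒length≤ (OneEdgePerLabel⇒DistinctLabels one) (∈-elements⁺ ∘ ∈labels⇒∈ess))
      (Unique∧⊆⇒length≤ (elements-unique (ess F)) λ x∈ →
        ∈-map⁺ label (proj₂ (Connected⇒edge (Isometric⇒Connected isometric) (∈-elements⁻ x∈)))) ⟩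
    length (elements (ess F))   ≡⟨ length-elements (ess F) ⟩
    ∣ ess F ∣                   ∎
    where open ≡-Reasoning

  -- By connectedness every essential label has an edge. If one label had two, its first edge could
  -- be avoided, and there would be more edges than essential labels.
  edgeCount⇒OneEdgePerLabel : Connected G → edgeCount G ≡ ∣ ess F ∣ → OneEdgePerLabel F
  edgeCount⇒OneEdgePerLabel connected count {A} {B} {x} A∈ Ax∈ B∈ Bx∈ A≡B with A ≟ˢ B
  ... | yes eq  = eq
  ... | no  A≢B = contradiction
    (injection⇒length< {R = λ x e → label e ≡ x} (λ p q → trans (sym p) q) (elements-unique (ess F))
      (λ x∈ → _ , proj₂ (Connected⇒edge connected (∈-elements⁻ x∈)) , refl)
      (∈-edges⁺ A∈ Ax∈)
      λ { refl → _ , ∈-edges⁺ B∈ Bx∈ , refl , λ eq → A≢B (sym (edgeAt-injective eq (sym A≡B))) })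
    (ℕ.<-irrefl (trans (length-elements (ess F)) (sym count)))

  -- The individual equivalences.

  Treelike⇒Tree : Treelike F → Tree G
  Treelike⇒Tree (treelike isometric one) = Isometric⇒Connected isometric , OneEdgePerLabel⇒acyclic one

  Connected⇒Treelike : Connected G → OneEdgePerLabel F → Treelike F
  Connected⇒Treelike connected one = treelike (Connected⇒Isometric one connected) one

  -- By isometry the distance from `⊥` is the Hamming distance, and it grows by one along an edge
  -- because the label is added.
  Treelike⇒UniformlyDirectedTree : Treelike F → ⊥ ∈ᶠ F → UniformlyDirectedTree G ⊥
  Treelike⇒UniformlyDirectedTree tl ⊥∈ = Treelike⇒Tree tl , ⊥∈ , closer
    where
    distance : ∀ {A} → A ∈ᶠ F → IsDistance G ⊥ A ∣ ⊥ △ A ∣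
    distance = Isometric⇒WellGraded (isometric tl) ⊥∈

    closer : ∀ {s l t} → (s , l , t) List.∈ edges G → CloserTo G ⊥ s t
    closer {s} {l} e∈ with s∈ , t∈ , eq , refl ← ∈-edges⁻ e∈ =
      _ , _ , distance s∈ , distance t∈ , ℕ.≤-reflexive (begin
        suc ∣ ⊥ △ s ∣       ≡⟨ cong (suc ∘ ∣_∣) (△-comm ⊥ s) ⟩
        suc ∣ s △ ⊥ ∣       ≡⟨ ∣△∣-agree s ⊥ (trans eq (sym (lookup-replicate l outside))) ⟨
        ∣ (s ⊕ l) △ ⊥ ∣     ≡⟨ cong ∣_∣ (△-comm (s ⊕ l) ⊥) ⟩
        ∣ ⊥ △ (s ⊕ l) ∣     ∎)
      where open ≡-Reasoning

  ess-count⇒Treelike : Isometric F → ∣ ess F ∣ + 1 ≡ size F → Treelike F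
  ess-count⇒Treelike isometric count = treelike isometric
    (UniqueDescent⇒OneEdgePerLabel isometric (ess-count⇒UniqueDescent isometric count))

  edge-count⇒Treelike : Isometric F → size F ≡ edgeCount G + 1 → Treelike F
  edge-count⇒Treelike isometric count = treelike isometric
    (UniqueDescent⇒OneEdgePerLabel isometric (edge-count⇒UniqueDescent isometric count))

  Treelike⇒WellGraded : Treelike F → WellGraded F
  Treelike⇒WellGraded tl = Isometric⇒WellGraded (isometric tl)

  Treelike⇒size≡edgeCount : Treelike F → size F ≡ edgeCount G + 1
  Treelike⇒size≡edgeCount tl = trans (sym (Treelike⇒size tl)) (cong (_+ 1) (sym (Treelike⇒edgeCount tl)))

  Treelike⇔WellGraded×VC≤1 : Treelike F ⇔ (WellGraded F × VCDimensionAtMost 1 F)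
  Treelike⇔WellGraded×VC≤1 = mk⇔ to from
    where
    to : Treelike F → WellGraded F × VCDimensionAtMost 1 F
    to tl = Treelike⇒WellGraded tl , Treelike⇒VC≤1 tl
    from : WellGraded F × VCDimensionAtMost 1 F → Treelike F
    from (wg , vc) = treelike (WellGraded⇒Isometric wg) (VC≤1⇒OneEdgePerLabel vc)

  Treelike⇔Extremal×VC≤1 : Treelike F ⇔ (Extremal F × VCDimensionAtMost 1 F)
  Treelike⇔Extremal×VC≤1 = mk⇔ to from
    where
    to : Treelike F → Extremal F × VCDimensionAtMost 1 F
    to tl = Treelike⇒Extremal tl , Treelike⇒VC≤1 tl
    from : Extremal F × VCDimensionAtMost 1 F → Treelike F
    from (extremal , vc) = Connected⇒Treelike (Extremal⇒Connected extremal vc) (VC≤1⇒OneEdgePerLabel vc)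

  Treelike⇔Connected×counts :
    Treelike F ⇔ (Connected G × ∣ ess F ∣ + 1 ≡ size F × size F ≡ edgeCount G + 1)
  Treelike⇔Connected×counts = mk⇔ to from
    where
    to : Treelike F → Connected G × ∣ ess F ∣ + 1 ≡ size F × size F ≡ edgeCount G + 1
    to tl = Isometric⇒Connected (isometric tl) , Treelike⇒size tl , Treelike⇒size≡edgeCount tl
    from : Connected G × ∣ ess F ∣ + 1 ≡ size F × size F ≡ edgeCount G + 1 → Treelike F
    from (connected , ess≡ , size≡) = Connected⇒Treelike connected
      (edgeCount⇒OneEdgePerLabel connected (ℕ.+-cancelʳ-≡ 1 _ _ (sym (trans ess≡ size≡))))

  Treelike⇔WellGraded×edgeCount : Treelike F ⇔ (WellGraded F × size F ≡ edgeCount G + 1)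
  Treelike⇔WellGraded×edgeCount = mk⇔ to from
    where
    to : Treelike F → WellGraded F × size F ≡ edgeCount G + 1
    to tl = Treelike⇒WellGraded tl , Treelike⇒size≡edgeCount tl
    from : WellGraded F × size F ≡ edgeCount G + 1 → Treelike F
    from (wg , size≡) = edge-count⇒Treelike (WellGraded⇒Isometric wg) size≡

  Treelike⇔WellGraded×essCount : Treelike F ⇔ (WellGraded F × ∣ ess F ∣ + 1 ≡ size F)
  Treelike⇔WellGraded×essCount = mk⇔ to from
    where
    to : Treelike F → WellGraded F × ∣ ess F ∣ + 1 ≡ size F
    to tl = Treelike⇒WellGraded tl , Treelike⇒size tl
    from : WellGraded F × ∣ ess F ∣ + 1 ≡ size F → Treelike F
    from (wg , ess≡) = ess-count⇒Treelike (WellGraded⇒Isometric wg) ess≡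

  Treelike⇔WellGraded×additionality : Treelike F ⇔ (WellGraded F × additionality F ≡ 1ℤ)
  Treelike⇔WellGraded×additionality = ⇔.trans Treelike⇔WellGraded×essCount (mk⇔ to from)
    where
    open Equivalence (m-n≡1⇔n+1≡m (size F) ∣ ess F ∣) using ()
      renaming (to to additionality⇒ess; from to ess⇒additionality)
    to : WellGraded F × ∣ ess F ∣ + 1 ≡ size F → WellGraded F × additionality F ≡ 1ℤ
    to = map₂ ess⇒additionality
    from : WellGraded F × additionality F ≡ 1ℤ → WellGraded F × ∣ ess F ∣ + 1 ≡ size F
    from = map₂ additionality⇒ess

  Treelike⇔Tree×DistinctLabels : Treelike F ⇔ (Tree G × DistinctLabels G)
  Treelike⇔Tree×DistinctLabels = mk⇔ to from
    where
    to : Treelike F → Tree G × DistinctLabels G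
    to tl = Treelike⇒Tree tl , OneEdgePerLabel⇒DistinctLabels (one tl)
    from : Tree G × DistinctLabels G → Treelike F
    from ((connected , _) , distinct) =
      Connected⇒Treelike connected (DistinctLabels⇒OneEdgePerLabel distinct)

  EssentialLabelling : Set
  EssentialLabelling = order G ≡ ∣ ess F ∣ + 1 × edgeCount G ≡ ∣ ess F ∣ × All (_∈ ess F) (labels G)
    × (∀ {x} → x ∈ ess F → ∃! _≡_ λ e → e List.∈ edges G × label e ≡ x)

  Treelike⇔Tree×EssentialLabelling : Treelike F ⇔ (Tree G × EssentialLabelling)
  Treelike⇔Tree×EssentialLabelling = mk⇔ to from
    where
    unique-edge : Treelike F → ∀ {x} → x ∈ ess F → ∃! _≡_ λ e → e List.∈ edges G × label e ≡ x
    unique-edge (treelike isometric one) x∈ =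
      let A , e∈ = Connected⇒edge (Isometric⇒Connected isometric) x∈ in
      _ , (e∈ , refl) , λ (e′∈ , eq) → OneEdgePerLabel⇒label-injective one e∈ e′∈ (sym eq)
    to : Treelike F → Tree G × EssentialLabelling
    to tl = Treelike⇒Tree tl , sym (Treelike⇒size tl) , Treelike⇒edgeCount tl
          , All.tabulate ∈labels⇒∈ess , unique-edge tl
    from : Tree G × EssentialLabelling → Treelike F
    from ((connected , _) , _ , edges≡ , _) =
      Connected⇒Treelike connected (edgeCount⇒OneEdgePerLabel connected edges≡)

-- Invariance under bit-flips and the rooted conditions.

module _ {F F′ : SetSystem n} (S : Subset n)
         (F⇒F′ : ∀ {C} → C ∈ᶠ F → C △ S ∈ᶠ F′) (F′⇒F : ∀ {C} → C ∈ᶠ F′ → C △ S ∈ᶠ F) where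

  Geodesic-△ : Geodesic F A B → Geodesic F′ (A △ S) (B △ S)
  Geodesic-△ done = done
  Geodesic-△ {A} {B} (step {x = x} A∈ Ax∈ ne g) =
    step (F⇒F′ A∈) (subst (_∈ᶠ F′) (⊕-△ A S x) (F⇒F′ Ax∈)) (ne ∘ lookup-△-cancelʳ A B S)
      (subst (λ T → Geodesic F′ T (B △ S)) (⊕-△ A S x) (Geodesic-△ g))

  -- Translation by `S` preserves undirected edges and their labels, and `Treelike` does not see the
  -- directions that it reverses. Two families related both ways let the same lemma serve for
  -- flipping and for flipping back.
  Treelike-△ : Treelike F → Treelike F′
  Treelike-△ (treelike isometric one) = treelike
    (λ {A} {B} A∈ B∈ → subst₂ (Geodesic F′) (△-involutive S A) (△-involutive S B)
      (Geodesic-△ (isometric (F′⇒F A∈) (F′⇒F B∈))))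
    λ {A} {B} {x} A∈ Ax∈ B∈ Bx∈ eq → △-cancelʳ S (one
      (F′⇒F A∈) (subst (_∈ᶠ F) (⊕-△ A S x) (F′⇒F Ax∈))
      (F′⇒F B∈) (subst (_∈ᶠ F) (⊕-△ B S x) (F′⇒F Bx∈))
      (lookup-△-congʳ A B S eq))

module _ (F : SetSystem n) (S : Subset n) where

  ∈-flip⁺ : A ∈ᶠ F → A △ S ∈ᶠ flip F S
  ∈-flip⁺ = ∈-map⁺ (_△ S)

  ∈-flip⁻ : A ∈ᶠ flip F S → A △ S ∈ᶠ F
  ∈-flip⁻ A∈ with C , C∈ , refl ← ∈-map⁻ (_△ S) A∈ = subst (_∈ᶠ F) (sym (△-involutive S C)) C∈

module _ (F : SetSystem n) where

  RootedAt : Subset n → Set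
  RootedAt A = UniformlyDirectedTree G′ ⊥ × DistinctLabels G′
    where G′ = oneInclusionGraph (flip F A)

  Treelike⇒RootedAt : Treelike F → A ∈ᶠ F → RootedAt A
  Treelike⇒RootedAt {A} tl A∈ =
      Treelike⇒UniformlyDirectedTree {F = flip F A} tl′ (subst (_∈ᶠ flip F A) (△-self A) (∈-flip⁺ F A A∈))
    , OneEdgePerLabel⇒DistinctLabels {F = flip F A} (one tl′)
    where
    tl′ : Treelike (flip F A)
    tl′ = Treelike-△ {F = F} A (∈-flip⁺ F A) (∈-flip⁻ F A) tl

  RootedAt⇒Treelike : RootedAt A → Treelike F
  RootedAt⇒Treelike {A} ((tree , _) , distinct) = Treelike-△ {F = flip F A} A (∈-flip⁻ F A) (∈-flip⁺ F A)
    (Treelike⇔Tree×DistinctLabels .Equivalence.from (tree , distinct))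

  Treelike⇔∀RootedAt : Treelike F ⇔ (∀ {A} → A ∈ᶠ F → RootedAt A)
  Treelike⇔∀RootedAt = mk⇔ to from
    where
    to : Treelike F → ∀ {A} → A ∈ᶠ F → RootedAt A
    to tl A∈ = Treelike⇒RootedAt tl A∈
    from : (∀ {A} → A ∈ᶠ F → RootedAt A) → Treelike F
    -- A member of `F` keeps the universal condition from being vacuous.
    from rooted = RootedAt⇒Treelike (rooted (proj₂ (nonempty F)))

  Treelike⇔∃RootedAt : Treelike F ⇔ (∃ λ A → A ∈ᶠ F × RootedAt A)
  Treelike⇔∃RootedAt = mk⇔ to from
    where
    to : Treelike F → ∃ λ A → A ∈ᶠ F × RootedAt A
    to tl = let A , A∈ = nonempty F in A , A∈ , Treelike⇒RootedAt tl A∈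
    from : (∃ λ A → A ∈ᶠ F × RootedAt A) → Treelike F
    from (_ , _ , rooted) = RootedAt⇒Treelike rooted

-- Pairwise equivalence through the common condition.

pairwise⇔ : ∀ {P : Set} {Ps : List Set} → All (P ⇔_) Ps → AllPairs _⇔_ Ps
pairwise⇔ []       = []
pairwise⇔ (e ∷ es) = All.map (⇔.trans (⇔.sym e)) es ∷ pairwise⇔ es

theorem3p7 : ∀ {n : ℕ} (F : SetSystem n) →
    let open LabelledDigraph
        G = oneInclusionGraph F
    in AllPairs _⇔_
      ( (WellGraded F × VCDimensionAtMost 1 F)
      ∷ (Extremal F × VCDimensionAtMost 1 F)
      ∷ (Connected G × ∣ ess F ∣ + 1 ≡ size F × size F ≡ edgeCount G + 1)
      ∷ (WellGraded F × size F ≡ edgeCount G + 1)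
      ∷ (WellGraded F × additionality F ≡ 1ℤ)
      ∷ (WellGraded F × ∣ ess F ∣ + 1 ≡ size F)
      ∷ (Tree G × DistinctLabels G)
      ∷ (Tree G × order G ≡ ∣ ess F ∣ + 1 × edgeCount G ≡ ∣ ess F ∣
          × All (_∈ ess F) (labels G)
          × (∀ {x} → x ∈ ess F →
               ∃! _≡_ λ e → e List.∈ edges G × label e ≡ x))
      ∷ (∀ {A} → A ∈ᶠ F →
          let G′ = oneInclusionGraph (flip F A)
          in UniformlyDirectedTree G′ ⊥ × DistinctLabels G′)
      ∷ (∃ λ A → A ∈ᶠ F ×
          (let G′ = oneInclusionGraph (flip F A)
           in UniformlyDirectedTree G′ ⊥ × DistinctLabels G′))
      ∷ [] )
theorem3p7 F = pairwise⇔ {P = Treelike F}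
  ( Treelike⇔WellGraded×VC≤1
  ∷ Treelike⇔Extremal×VC≤1
  ∷ Treelike⇔Connected×counts
  ∷ Treelike⇔WellGraded×edgeCount
  ∷ Treelike⇔WellGraded×additionality
  ∷ Treelike⇔WellGraded×essCount
  ∷ Treelike⇔Tree×DistinctLabels
  ∷ Treelike⇔Tree×EssentialLabelling
  ∷ Treelike⇔∀RootedAt F
  ∷ Treelike⇔∃RootedAt F
  ∷ [] )
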